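{- Let $I$ be a dense linear order with a left endpoint $0$ and no right endpoint, and let $\mathcal{L}(I)$ be the structure described in the context. Then $\mathcal{L}(I)$ is model-complete: every first-order formula in its signature is equivalent in $\mathcal{L}(I)$ to an existential formula.
   Context: Let $\mathcal{P}_{\mathrm{fci}}(I)$ be the set of finite unions of closed intervals of $I$. Here a closed interval is a set of the form $[i,j]=\{k: i\le k\le j\}$, $[i,+\infty)=\{k: i\le k\}$ or $(-\infty,j]=\{k:k\le j\}$ with $i,j\in I$. Let $\mathcal{L}(I)$ be the structure with universe $\mathcal{P}_{\mathrm{fci}}(I)$ in the signature $\{\cup,\cap,\bot,c_0,\min,\max,l,r\}$, interpreted as follows. - $\cup$ and $\cap$ are union and intersection. - $\bot$ is $\emptyset$, and $c_0$ is $\{0\}$. - $\min(A)$ is the singleton of the least element of $A$, with $\min(\emptyset)=\emptyset$. - $\max(A)$ is the singleton of the greatest element of $A$ when $A$ is nonempty and bounded, and $\emptyset$ when $A$ is empty or unbounded. - $l(A)$ is the set of left endpoints of $A$, and $r(A)$ is the set of right endpoints of $A$. Endpoints are defined via the maximal closed intervals whose finite union is $A$. The left endpoints are the minima of these intervals. The right endpoints are the maxima of the bounded ones. -}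

module Defs where

open import Level using (Level; _⊔_; Lift; lift) renaming (suc to lsuc)
open import Data.Nat.Base using (ℕ; suc)
open import Data.Fin.Base using (Fin)
open import Data.Vec.Base using (Vec; _∷_; lookup)
open import Data.List.Base using (List; []; _∷_; _++_; map; mapMaybe)
open import Data.List.Relation.Unary.Any as Any using (Any; here; there)
open import Data.List.Relation.Unary.Any.Properties
  using (++⁺ˡ; ++⁺ʳ; ++⁻; map⁺; map⁻)
open import Data.List.Relation.Unary.All as All using (All; []; _∷_)
open import Data.List.Relation.Unary.AllPairs using (AllPairs; []; _∷_)
open import Data.List.Membership.Propositional as Mem using (find; lose)
open import Data.Maybe.Base as Maybe using (Maybe; just; nothing)
open import Data.Product using (Σ; ∃; ∃-syntax; _×_; _,_; proj₁; proj₂)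
open import Data.Sum.Base using (_⊎_; inj₁; inj₂; [_,_]′)
open import Data.Unit.Polymorphic.Base using (⊤; tt)
open import Data.Empty using (⊥-elim)
open import Data.Empty.Polymorphic using (⊥)
open import Function.Base using (_∘_; id)
open import Relation.Binary.Bundles
  using (DenseLinearOrder; DecTotalOrder; StrictTotalOrder)
open import Relation.Binary.Definitions using (Minimum; tri<; tri≈; tri>)
import Relation.Binary.Properties.StrictTotalOrder as StrictTotalOrderProperties
open import Relation.Binary.PropositionalEquality.Core using (_≡_; refl; sym)
open import Relation.Nullary using (¬_; Dec; yes; no)
open import Relation.Unary using (Pred; _∈_; _⊆_; _≐_; _∪_; _∩_)

-- Equality is the only relation symbol.  Variables are de Bruijn indices:
-- the innermost quantifier binds variable zero.

infix  9 #_
infixl 8 _∩′_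
infixl 7 _∪′_
infix  6 _≐′_
infix  5 ¬′_
infixr 4 _∧′_
infixr 3 _∨′_
infixr 2 _⇒′_
infix  1 ∀′_ ∃′_

data Term (n : ℕ) : Set where
  #_                  : Fin n → Term n
  _∪′_ _∩′_           : Term n → Term n → Term n
  ⊥′ c₀               : Term n
  min′ max′ l′ r′     : Term n → Term n

data Formula (n : ℕ) : Set where
  _≐′_                : Term n → Term n → Formula n
  ¬′_                 : Formula n → Formula n
  _∧′_ _∨′_ _⇒′_      : Formula n → Formula n → Formula n
  ∀′_ ∃′_             : Formula (suc n) → Formula n

data QuantifierFree {n : ℕ} : Formula n → Set where
  _≐′_ : ∀ s t → QuantifierFree (s ≐′ t)
  ¬′_  : ∀ {φ} → QuantifierFree φ → QuantifierFree (¬′ φ)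
  _∧′_ : ∀ {φ ψ} → QuantifierFree φ → QuantifierFree ψ → QuantifierFree (φ ∧′ ψ)
  _∨′_ : ∀ {φ ψ} → QuantifierFree φ → QuantifierFree ψ → QuantifierFree (φ ∨′ ψ)
  _⇒′_ : ∀ {φ ψ} → QuantifierFree φ → QuantifierFree ψ → QuantifierFree (φ ⇒′ ψ)

data Existential : {n : ℕ} → Formula n → Set where
  quantifierFree : ∀ {n} {φ : Formula n} → QuantifierFree φ → Existential φ
  ∃′_            : ∀ {n} {φ : Formula (suc n)} → Existential φ → Existential (∃′ φ)

-- The strict order is trichotomous (hence decidable) and density and the
-- absence of a right endpoint provide witnesses; classically this is no
-- restriction on dense linear orders.

record LeftClosedDenseLinearOrder c ℓ₁ ℓ₂ : Set (lsuc (c ⊔ ℓ₁ ⊔ ℓ₂)) where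
  field
    denseLinearOrder : DenseLinearOrder c ℓ₁ ℓ₂

  open DenseLinearOrder denseLinearOrder public
    using (Carrier; _≈_; _<_; dense; strictTotalOrder)
  open StrictTotalOrderProperties strictTotalOrder public
    using (_≤_; decTotalOrder)

  field
    0#                : Carrier
    0#-minimum        : Minimum _≤_ 0#
    no-right-endpoint : ∀ x → ∃[ y ] x < y

module 𝓛 {c ℓ₁ ℓ₂ : Level} (I : LeftClosedDenseLinearOrder c ℓ₁ ℓ₂) where

  open LeftClosedDenseLinearOrder I

  private
    ℓ : Level
    ℓ = c ⊔ ℓ₁ ⊔ ℓ₂

  Subset : Set (lsuc ℓ)
  Subset = Pred Carrier ℓ

  data ClosedInterval : Set c where
    [_,_]   : Carrier → Carrier → ClosedInterval
    [_,+∞⟩  : Carrier → ClosedInterval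
    ⟨-∞,_]  : Carrier → ClosedInterval

  ⟦_⟧ : ClosedInterval → Pred Carrier (ℓ₁ ⊔ ℓ₂)
  ⟦ [ i , j ] ⟧ k = i ≤ k × k ≤ j
  ⟦ [ i ,+∞⟩ ⟧ k = i ≤ k
  ⟦ ⟨-∞, j ] ⟧ k = k ≤ j

  ⋃ : List ClosedInterval → Subset
  ⋃ Js k = Any (λ J → k ∈ ⟦ J ⟧) Js

  IsFci : Subset → Set ℓ
  IsFci A = ∃[ Js ] A ≐ ⋃ Js

  -- Elements are compared by extensional equality _≐_ of the underlying
  -- subsets, never by the chosen list of intervals.
  𝒫fci : Set (lsuc ℓ)
  𝒫fci = Σ Subset IsFci

  IsLeast IsGreatest : ∀ {p} → Pred Carrier p → Pred Carrier (c ⊔ ℓ₁ ⊔ ℓ₂ ⊔ p)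
  IsLeast    A x = x ∈ A × (∀ y → y ∈ A → x ≤ y)
  IsGreatest A x = x ∈ A × (∀ y → y ∈ A → y ≤ x)

  Singleton : Carrier → Subset
  Singleton a x = Lift ℓ (x ≈ a)

  -- Each of these is the singleton of the extremal element, or ∅ if there
  -- is none.  As I has no right endpoint, an unbounded set has no greatest
  -- element; a nonempty finite union of closed intervals has a greatest
  -- element exactly when it is bounded, and always has a least one.
  Min Max : Subset → Subset
  Min A = IsLeast A
  Max A = IsGreatest A

  -- The degenerate interval [ i , j ] with j < i is maximal only in A = ∅, and
  -- has no extremal elements, so it never contributes an endpoint.
  IsMaximalIn : Subset → ClosedInterval → Set ℓ
  IsMaximalIn A J =
    ⟦ J ⟧ ⊆ A × (∀ K → ⟦ J ⟧ ⊆ ⟦ K ⟧ → ⟦ K ⟧ ⊆ A → ⟦ K ⟧ ⊆ ⟦ J ⟧)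

  -- By density and unboundedness, the maximal closed intervals contained in a
  -- nonempty finite union of closed intervals A are finitely many, pairwise
  -- disjoint, and have union A; the bounded ones are those with a greatest
  -- element.
  LeftEnds RightEnds : Subset → Subset
  LeftEnds  A x = ∃[ J ] IsMaximalIn A J × IsLeast ⟦ J ⟧ x
  RightEnds A x = ∃[ J ] IsMaximalIn A J × IsGreatest ⟦ J ⟧ x

  module NormalForms where
    module ≤ = DecTotalOrder decTotalOrder
    module < = StrictTotalOrder strictTotalOrder

    ≤-or-> : ∀ x y → x ≤ y ⊎ y < x
    ≤-or-> x y with <.compare x y
    ... | tri< x<y _ _ = inj₁ (inj₁ x<y)
    ... | tri≈ _ x≈y _ = inj₁ (inj₂ x≈y)
    ... | tri> _ _ y<x = inj₂ y<x

    <⇒≱ : ∀ {x y} → x < y → ¬ (y ≤ x)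
    <⇒≱ x<y (inj₁ y<x) = <.asym x<y y<x
    <⇒≱ x<y (inj₂ y≈x) = <.irrefl (<.Eq.sym y≈x) x<y

    ≤-<-trans : ∀ {x y z} → x ≤ y → y < z → x < z
    ≤-<-trans (inj₁ x<y) y<z = <.trans x<y y<z
    ≤-<-trans (inj₂ x≈y) y<z = <.<-respˡ-≈ (<.Eq.sym x≈y) y<z

    lower : ∀ x y → ∃[ m ] m ≤ x × m ≤ y × (m ≡ x ⊎ m ≡ y)
    lower x y with ≤.total x y
    ... | inj₁ x≤y = x , ≤.refl , x≤y , inj₁ refl
    ... | inj₂ y≤x = y , y≤x , ≤.refl , inj₂ refl

    upper : ∀ x y → ∃[ m ] x ≤ m × y ≤ m × (m ≡ x ⊎ m ≡ y)
    upper x y with ≤.total x y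
    ... | inj₁ x≤y = y , x≤y , ≤.refl , inj₂ refl
    ... | inj₂ y≤x = x , ≤.refl , y≤x , inj₁ refl

    -- Upper bounds in I ∪ {+∞}, with nothing as +∞.
    _≤⁺_ : Carrier → Maybe Carrier → Set (ℓ₁ ⊔ ℓ₂)
    x ≤⁺ just b  = x ≤ b
    x ≤⁺ nothing = ⊤

    ≤⁺-trans : ∀ {x y} h → x ≤ y → y ≤⁺ h → x ≤⁺ h
    ≤⁺-trans (just b) x≤y y≤b = ≤.trans x≤y y≤b
    ≤⁺-trans nothing  _   _   = tt

    _≤⁺?_ : ∀ x h → Dec (x ≤⁺ h)
    x ≤⁺? just b  = x ≤.≤? b
    x ≤⁺? nothing = yes tt

    lower⁺ : ∀ g h → ∃[ m ] ((∀ x → x ≤⁺ m → x ≤⁺ g × x ≤⁺ h) × (m ≡ g ⊎ m ≡ h))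
    lower⁺ nothing  h        = h , (λ x p → tt , p) , inj₂ refl
    lower⁺ (just a) nothing  = just a , (λ x p → p , tt) , inj₁ refl
    lower⁺ (just a) (just b) with lower a b
    ... | m , m≤a , m≤b , inj₁ refl = just m , (λ x p → p , ≤.trans p m≤b) , inj₁ refl
    ... | m , m≤a , m≤b , inj₂ refl = just m , (λ x p → ≤.trans p m≤a , p) , inj₂ refl

    upper⁺ : ∀ g h → ∃[ m ] ((∀ x → x ≤⁺ g ⊎ x ≤⁺ h → x ≤⁺ m) × (m ≡ g ⊎ m ≡ h))
    upper⁺ nothing  h        = nothing , (λ _ _ → tt) , inj₁ refl
    upper⁺ (just a) nothing  = nothing , (λ _ _ → tt) , inj₂ refl
    upper⁺ (just a) (just b) with upper a b
    ... | m , a≤m , b≤m , inj₁ refl =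
      just m , (λ { x (inj₁ p) → p ; x (inj₂ p) → ≤.trans p b≤m }) , inj₁ refl
    ... | m , a≤m , b≤m , inj₂ refl =
      just m , (λ { x (inj₁ p) → ≤.trans p a≤m ; x (inj₂ p) → p }) , inj₂ refl

    record NonEmptyInterval : Set ℓ where
      constructor interval
      field
        lo       : Carrier
        hi       : Maybe Carrier
        nonEmpty : lo ≤⁺ hi

    open NonEmptyInterval public

    ⟪_⟫ : NonEmptyInterval → Pred Carrier (ℓ₁ ⊔ ℓ₂)
    ⟪ J ⟫ x = lo J ≤ x × x ≤⁺ hi J

    ⋃⁺ : List NonEmptyInterval → Subset
    ⋃⁺ Js x = Any (λ J → x ∈ ⟪ J ⟫) Js

    lo∈ : ∀ J → lo J ∈ ⟪ J ⟫
    lo∈ J = ≤.refl , nonEmpty J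

    toClosed : NonEmptyInterval → ClosedInterval
    toClosed (interval i (just j) _) = [ i , j ]
    toClosed (interval i nothing  _) = [ i ,+∞⟩

    toClosed-≐ : ∀ J → ⟦ toClosed J ⟧ ≐ ⟪ J ⟫
    toClosed-≐ (interval i (just j) _) = id , id
    toClosed-≐ (interval i nothing  _) = (_, tt) , proj₁

    fromClosed : ∀ J → (∀ x → ¬ (x ∈ ⟦ J ⟧)) ⊎ (∃[ K ] ⟦ J ⟧ ≐ ⟪ K ⟫)
    fromClosed [ i , j ] with i ≤.≤? j
    ... | yes i≤j = inj₂ (interval i (just j) i≤j , id , id)
    ... | no  i≰j = inj₁ (λ x (i≤x , x≤j) → i≰j (≤.trans i≤x x≤j))
    fromClosed [ i ,+∞⟩ = inj₂ (interval i nothing tt , (_, tt) , proj₁)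
    fromClosed ⟨-∞, j ] =
      inj₂ (interval 0# (just j) (0#-minimum j) , (λ {x} p → 0#-minimum x , p) , proj₂)

    singleton⁺ : Carrier → NonEmptyInterval
    singleton⁺ a = interval a (just a) ≤.refl

    singleton⁺-≐ : ∀ {a x} → x ≈ a → x ∈ ⟪ singleton⁺ a ⟫
    singleton⁺-≐ x≈a = inj₂ (<.Eq.sym x≈a) , inj₂ x≈a

    singleton⁺-≈ : ∀ {a x} → x ∈ ⟪ singleton⁺ a ⟫ → x ≈ a
    singleton⁺-≈ (a≤x , x≤a) = ≤.antisym x≤a a≤x

    toFci : ∀ {A : Subset} Js → A ≐ ⋃⁺ Js → IsFci A
    toFci Js (A⊆ , ⊆A) =
      map toClosed Js ,
      (λ x∈A → map⁺ (Any.map (λ {J} → proj₂ (toClosed-≐ J)) (A⊆ x∈A))) ,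
      (λ x∈⋃ → ⊆A (Any.map (λ {J} → proj₁ (toClosed-≐ J)) (map⁻ x∈⋃)))

    convex : ∀ J {x y z} → x ∈ ⟪ J ⟫ → z ∈ ⟪ J ⟫ → x ≤ y → y ≤ z → y ∈ ⟪ J ⟫
    convex J (l≤x , _) (_ , z≤h) x≤y y≤z = ≤.trans l≤x x≤y , ≤⁺-trans (hi J) y≤z z≤h

    Disjoint : NonEmptyInterval → NonEmptyInterval → Set ℓ
    Disjoint J K = ∀ x → x ∈ ⟪ J ⟫ → ¬ (x ∈ ⟪ K ⟫)

    intersect : ∀ J K → Disjoint J K ⊎ (∃[ L ] ⟪ L ⟫ ≐ ⟪ J ⟫ ∩ ⟪ K ⟫)
    intersect J K with upper (lo J) (lo K) | lower⁺ (hi J) (hi K)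
    ... | m , j≤m , k≤m , m≡ | h , h≤ , h≡ with m ≤⁺? h
    ... | yes m≤h = inj₂ (interval m h m≤h ,
            (λ {x} (m≤x , x≤h) → (≤.trans j≤m m≤x , proj₁ (h≤ x x≤h)) ,
                                 (≤.trans k≤m m≤x , proj₂ (h≤ x x≤h))) ,
            (λ {x} p → lo-case m≡ p , hi-case h≡ p))
      where
      lo-case : ∀ {m x} → m ≡ lo J ⊎ m ≡ lo K → x ∈ ⟪ J ⟫ ∩ ⟪ K ⟫ → m ≤ x
      lo-case (inj₁ refl) (p , q) = proj₁ p
      lo-case (inj₂ refl) (p , q) = proj₁ q
      hi-case : ∀ {h x} → h ≡ hi J ⊎ h ≡ hi K → x ∈ ⟪ J ⟫ ∩ ⟪ K ⟫ → x ≤⁺ h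
      hi-case (inj₁ refl) (p , q) = proj₂ p
      hi-case (inj₂ refl) (p , q) = proj₂ q
    ... | no  m≰h = inj₁ (λ x p q → m≰h (≤⁺-trans h (lo-case m≡ p q) (hi-case h≡ p q)))
      where
      lo-case : ∀ {m x} → m ≡ lo J ⊎ m ≡ lo K → x ∈ ⟪ J ⟫ → x ∈ ⟪ K ⟫ → m ≤ x
      lo-case (inj₁ refl) p q = proj₁ p
      lo-case (inj₂ refl) p q = proj₁ q
      hi-case : ∀ {h x} → h ≡ hi J ⊎ h ≡ hi K → x ∈ ⟪ J ⟫ → x ∈ ⟪ K ⟫ → x ≤⁺ h
      hi-case (inj₁ refl) p q = proj₂ p
      hi-case (inj₂ refl) p q = proj₂ q

    join : ∀ J K {x} → x ∈ ⟪ J ⟫ → x ∈ ⟪ K ⟫ → ∃[ L ] ⟪ L ⟫ ≐ ⟪ J ⟫ ∪ ⟪ K ⟫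
    join J K {x} x∈J x∈K with lower (lo J) (lo K) | upper⁺ (hi J) (hi K)
    ... | m , m≤j , m≤k , m≡ | h , ≤h , h≡ =
      interval m h (≤⁺-trans h (≤.trans m≤j (proj₁ x∈J)) (≤h x (inj₁ (proj₂ x∈J)))) ,
      (λ p → to m≡ h≡ p) ,
      (λ { {y} (inj₁ (p , q)) → ≤.trans m≤j p , ≤h y (inj₁ q)
         ; {y} (inj₂ (p , q)) → ≤.trans m≤k p , ≤h y (inj₂ q) })
      where
      to : ∀ {m h y} → m ≡ lo J ⊎ m ≡ lo K → h ≡ hi J ⊎ h ≡ hi K →
           m ≤ y × y ≤⁺ h → y ∈ ⟪ J ⟫ ∪ ⟪ K ⟫
      to {y = y} m≡ h≡ (m≤y , y≤h) with ≤.total y x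
      to (inj₁ refl) _ (m≤y , _) | inj₁ y≤x = inj₁ (m≤y , ≤⁺-trans (hi J) y≤x (proj₂ x∈J))
      to (inj₂ refl) _ (m≤y , _) | inj₁ y≤x = inj₂ (m≤y , ≤⁺-trans (hi K) y≤x (proj₂ x∈K))
      to _ (inj₁ refl) (_ , y≤h) | inj₂ x≤y = inj₁ (≤.trans (proj₁ x∈J) x≤y , y≤h)
      to _ (inj₂ refl) (_ , y≤h) | inj₂ x≤y = inj₂ (≤.trans (proj₁ x∈K) x≤y , y≤h)

    Normal : List NonEmptyInterval → Set ℓ
    Normal = AllPairs Disjoint

    insert : ∀ J Ks → Normal Ks → ∃[ Ls ] Normal Ls × ⋃⁺ Ls ≐ ⟪ J ⟫ ∪ ⋃⁺ Ks
    insert J [] [] =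
      J ∷ [] , [] ∷ [] , (λ { (here p) → inj₁ p }) , (λ { (inj₁ p) → here p })
    insert J (K ∷ Ks) (K# ∷ nKs) with intersect J K
    ... | inj₂ (M , M⊆ , _) with join J K (proj₁ (M⊆ (lo∈ M))) (proj₂ (M⊆ (lo∈ M)))
    ...   | H , H⊆ , ⊆H with insert H Ks nKs
    ...     | Ls , nLs , Ls⊆ , ⊆Ls = Ls , nLs , to ∘ Ls⊆ , ⊆Ls ∘ from
      where
      to : ⟪ H ⟫ ∪ ⋃⁺ Ks ⊆ ⟪ J ⟫ ∪ ⋃⁺ (K ∷ Ks)
      to (inj₁ p) = [ inj₁ , inj₂ ∘ here ]′ (H⊆ p)
      to (inj₂ p) = inj₂ (there p)
      from : ⟪ J ⟫ ∪ ⋃⁺ (K ∷ Ks) ⊆ ⟪ H ⟫ ∪ ⋃⁺ Ks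
      from (inj₁ p)         = inj₁ (⊆H (inj₁ p))
      from (inj₂ (here p))  = inj₁ (⊆H (inj₂ p))
      from (inj₂ (there p)) = inj₂ p
    insert J (K ∷ Ks) (K# ∷ nKs) | inj₁ J#K with insert J Ks nKs
    ... | Ls , nLs , Ls⊆ , ⊆Ls = K ∷ Ls , All.tabulate K#Ls ∷ nLs , to , from
      where
      K#Ls : ∀ {L} → L Mem.∈ Ls → Disjoint K L
      K#Ls L∈Ls x x∈K x∈L with Ls⊆ (lose L∈Ls x∈L)
      ... | inj₁ x∈J = J#K x x∈J x∈K
      ... | inj₂ x∈Ks with find x∈Ks
      ...   | M , M∈Ks , x∈M = All.lookup K# M∈Ks x x∈K x∈M
      to : ⋃⁺ (K ∷ Ls) ⊆ ⟪ J ⟫ ∪ ⋃⁺ (K ∷ Ks)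
      to (here p)  = inj₂ (here p)
      to (there p) = [ inj₁ , inj₂ ∘ there ]′ (Ls⊆ p)
      from : ⟪ J ⟫ ∪ ⋃⁺ (K ∷ Ks) ⊆ ⋃⁺ (K ∷ Ls)
      from (inj₁ p)         = there (⊆Ls (inj₁ p))
      from (inj₂ (here p))  = here p
      from (inj₂ (there p)) = there (⊆Ls (inj₂ p))

    normalise : ∀ Js → ∃[ Ks ] Normal Ks × ⋃ Js ≐ ⋃⁺ Ks
    normalise [] = [] , [] , (λ ()) , (λ ())
    normalise (J ∷ Js) with fromClosed J | normalise Js
    ... | inj₁ J=∅ | Ks , nKs , f , g =
      Ks , nKs , (λ { (here p) → ⊥-elim (J=∅ _ p) ; (there p) → f p }) , there ∘ g
    ... | inj₂ (J′ , j , j⁻) | Ks , nKs , f , g with insert J′ Ks nKs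
    ...   | Ls , nLs , u , v =
      Ls , nLs ,
      (λ { (here p) → v (inj₁ (j p)) ; (there p) → v (inj₂ (f p)) }) ,
      (λ p → [ here ∘ j⁻ , there ∘ g ]′ (u p))

    normalForm : ∀ {A : Subset} → IsFci A → ∃[ Ks ] Normal Ks × A ≐ ⋃⁺ Ks
    normalForm (Js , A⊆ , ⊆A) with normalise Js
    ... | Ks , nKs , f , g = Ks , nKs , f ∘ A⊆ , ⊆A ∘ g

    unique : ∀ {Ks J K x} → Normal Ks → J Mem.∈ Ks → K Mem.∈ Ks →
             x ∈ ⟪ J ⟫ → x ∈ ⟪ K ⟫ → J ≡ K
    unique _          (here refl) (here refl) _ _ = refl
    unique (J# ∷ _)   (here refl) (there K∈)  p q = ⊥-elim (All.lookup J# K∈ _ p q)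
    unique (K# ∷ _)   (there J∈)  (here refl) p q = ⊥-elim (All.lookup K# J∈ _ q p)
    unique (_ ∷ nKs)  (there J∈)  (there K∈)  p q = unique nKs J∈ K∈ p q

    -- Close enough to p on the left (resp. right), every interval of Ks
    -- reaching that close also contains p.
    settleˡ : ∀ Ks {y p} → y < p → ∃[ y′ ] y ≤ y′ × y′ < p ×
              (∀ {J z} → J Mem.∈ Ks → y′ < z → z < p → z ∈ ⟪ J ⟫ → p ∈ ⟪ J ⟫)
    settleˡ [] {y} y<p = y , ≤.refl , y<p , λ ()
    settleˡ (K ∷ Ks) {y} {p} y<p with settleˡ Ks y<p
    ... | y₁ , y≤y₁ , y₁<p , ok with hi K in eq
    ... | nothing = y₁ , y≤y₁ , y₁<p , ok′
      where
      ok′ : ∀ {J z} → J Mem.∈ K ∷ Ks → y₁ < z → z < p → z ∈ ⟪ J ⟫ → p ∈ ⟪ J ⟫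
      ok′ (here refl) _ z<p z∈J rewrite eq = ≤.trans (proj₁ z∈J) (inj₁ z<p) , tt
      ok′ (there J∈) = ok J∈
    ... | just b with ≤-or-> p b
    ...   | inj₁ p≤b = y₁ , y≤y₁ , y₁<p , ok′
      where
      ok′ : ∀ {J z} → J Mem.∈ K ∷ Ks → y₁ < z → z < p → z ∈ ⟪ J ⟫ → p ∈ ⟪ J ⟫
      ok′ (here refl) _ z<p z∈J rewrite eq = ≤.trans (proj₁ z∈J) (inj₁ z<p) , p≤b
      ok′ (there J∈) = ok J∈
    ...   | inj₂ b<p with upper y₁ b
    ...     | m , y₁≤m , b≤m , m≡ = m , ≤.trans y≤y₁ y₁≤m , m<p m≡ , ok′
      where
      m<p : ∀ {m} → m ≡ y₁ ⊎ m ≡ b → m < p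
      m<p (inj₁ refl) = y₁<p
      m<p (inj₂ refl) = b<p
      ok′ : ∀ {J z} → J Mem.∈ K ∷ Ks → m < z → z < p → z ∈ ⟪ J ⟫ → p ∈ ⟪ J ⟫
      ok′ (here refl) m<z _ z∈J rewrite eq =
        ⊥-elim (<⇒≱ m<z (≤.trans (proj₂ z∈J) b≤m))
      ok′ (there J∈) m<z z<p z∈J with ≤-or-> m y₁
      ... | inj₂ y₁<m = ok J∈ (<.trans y₁<m m<z) z<p z∈J
      ... | inj₁ m≤y₁ with ≤-or-> _ y₁
      ...   | inj₂ y₁<z = ok J∈ y₁<z z<p z∈J
      ...   | inj₁ z≤y₁ = ⊥-elim (<⇒≱ m<z (≤.trans z≤y₁ y₁≤m))

    settleʳ : ∀ Ks {y p} → p < y → ∃[ y′ ] y′ ≤ y × p < y′ ×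
              (∀ {J z} → J Mem.∈ Ks → p < z → z < y′ → z ∈ ⟪ J ⟫ → p ∈ ⟪ J ⟫)
    settleʳ [] {y} p<y = y , ≤.refl , p<y , λ ()
    settleʳ (K ∷ Ks) {y} {p} p<y with settleʳ Ks p<y
    ... | y₁ , y₁≤y , p<y₁ , ok with ≤-or-> (lo K) p
    ... | inj₁ l≤p = y₁ , y₁≤y , p<y₁ , ok′
      where
      ok′ : ∀ {J z} → J Mem.∈ K ∷ Ks → p < z → z < y₁ → z ∈ ⟪ J ⟫ → p ∈ ⟪ J ⟫
      ok′ (here refl) p<z _ z∈J = l≤p , ≤⁺-trans (hi K) (inj₁ p<z) (proj₂ z∈J)
      ok′ (there J∈) = ok J∈
    ... | inj₂ p<l with lower y₁ (lo K)
    ...   | m , m≤y₁ , m≤l , m≡ = m , ≤.trans m≤y₁ y₁≤y , p<m m≡ , ok′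
      where
      p<m : ∀ {m} → m ≡ y₁ ⊎ m ≡ lo K → p < m
      p<m (inj₁ refl) = p<y₁
      p<m (inj₂ refl) = p<l
      ok′ : ∀ {J z} → J Mem.∈ K ∷ Ks → p < z → z < m → z ∈ ⟪ J ⟫ → p ∈ ⟪ J ⟫
      ok′ (here refl) _ z<m z∈J = ⊥-elim (<⇒≱ z<m (≤.trans m≤l (proj₁ z∈J)))
      ok′ (there J∈) p<z z<m z∈J with ≤-or-> y₁ _
      ... | inj₂ z<y₁ = ok J∈ p<z z<y₁ z∈J
      ... | inj₁ y₁≤z = ⊥-elim (<⇒≱ z<m (≤.trans m≤y₁ y₁≤z))

    normal-maximal : ∀ {A : Subset} {Ks K} → Normal Ks → A ≐ ⋃⁺ Ks → K Mem.∈ Ks →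
                     ∀ L → ⟪ K ⟫ ⊆ ⟪ L ⟫ → ⟪ L ⟫ ⊆ A → ⟪ L ⟫ ⊆ ⟪ K ⟫
    normal-maximal {A} {Ks} {K} nKs (A⊆ , _) K∈ L K⊆L L⊆A {x} x∈L = lo-ok , hi-ok (hi K) refl
      where
      lo-ok : lo K ≤ x
      lo-ok with ≤-or-> (lo K) x
      ... | inj₁ l≤x = l≤x
      ... | inj₂ x<l with settleˡ Ks x<l
      ...   | y , x≤y , y<l , ok with dense y<l
      ...     | z , y<z , z<l
        with find (A⊆ (L⊆A (convex L x∈L (K⊆L (lo∈ K)) (≤.trans x≤y (inj₁ y<z)) (inj₁ z<l))))
      ...       | J , J∈ , z∈J with unique nKs J∈ K∈ (ok J∈ y<z z<l z∈J) (lo∈ K)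
      ...         | refl = ⊥-elim (<⇒≱ z<l (proj₁ z∈J))
      hi-ok : ∀ h → h ≡ hi K → x ≤⁺ hi K
      hi-ok nothing  eq rewrite sym eq = tt
      hi-ok (just b) eq with ≤-or-> x b
      ... | inj₁ x≤b rewrite sym eq = x≤b
      ... | inj₂ b<x with settleʳ Ks b<x
      ...   | y , y≤x , b<y , ok with dense b<y
      ...     | z , b<z , z<y with b∈K eq
        where
        b∈K : just b ≡ hi K → b ∈ ⟪ K ⟫
        b∈K eq with hi K | nonEmpty K
        b∈K refl | just _ | ne = ne , ≤.refl
      ...       | b∈K
        with find (A⊆ (L⊆A (convex L (K⊆L b∈K) x∈L (inj₁ b<z) (≤.trans (inj₁ z<y) y≤x))))
      ...         | J , J∈ , z∈J with unique nKs J∈ K∈ (ok J∈ b<z z<y z∈J) b∈K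
      ...           | refl = ⊥-elim (absurd eq (proj₂ z∈J))
        where
        absurd : ∀ {h} → just b ≡ h → ¬ (z ≤⁺ h)
        absurd refl z≤b = <⇒≱ b<z z≤b

    normal-isMaximal : ∀ {A : Subset} {Ks K} → Normal Ks → A ≐ ⋃⁺ Ks → K Mem.∈ Ks →
                       IsMaximalIn A (toClosed K)
    normal-isMaximal {K = K} nKs A≐ K∈ =
      (λ p → proj₂ A≐ (lose K∈ (proj₁ (toClosed-≐ K) p))) ,
      λ L K⊆L L⊆A {x} x∈L → case L (fromClosed L) K⊆L L⊆A x∈L
      where
      case : ∀ L → (∀ x → ¬ (x ∈ ⟦ L ⟧)) ⊎ (∃[ M ] ⟦ L ⟧ ≐ ⟪ M ⟫) →
             ⟦ toClosed K ⟧ ⊆ ⟦ L ⟧ → ⟦ L ⟧ ⊆ _ → ⟦ L ⟧ ⊆ ⟦ toClosed K ⟧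
      case L (inj₁ L=∅) _ _ x∈L = ⊥-elim (L=∅ _ x∈L)
      case L (inj₂ (M , L⊆M , M⊆L)) K⊆L L⊆A x∈L =
        proj₂ (toClosed-≐ K)
          (normal-maximal nKs A≐ K∈ M (L⊆M ∘ K⊆L ∘ proj₂ (toClosed-≐ K)) (L⊆A ∘ M⊆L) (L⊆M x∈L))

    isMaximal⇒normal : ∀ {A : Subset} {Ks J x} → Normal Ks → A ≐ ⋃⁺ Ks → IsMaximalIn A J → x ∈ ⟦ J ⟧ →
                       ∃[ K ] K Mem.∈ Ks × ⟦ J ⟧ ≐ ⟪ K ⟫
    isMaximal⇒normal {J = J} nKs A≐ (J⊆A , J-max) x∈J with fromClosed J
    ... | inj₁ J=∅ = ⊥-elim (J=∅ _ x∈J)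
    ... | inj₂ (M , J⊆M , M⊆J) with find (proj₁ A≐ (J⊆A x∈J))
    ...   | K , K∈ , x∈K with join M K (J⊆M x∈J) x∈K
    ...     | L , L⊆ , ⊆L =
      K , K∈ ,
      (λ p → normal-maximal nKs A≐ K∈ L (⊆L ∘ inj₂) L⊆A (⊆L (inj₁ (J⊆M p)))) ,
      (λ p → J-max (toClosed L)
               (proj₂ (toClosed-≐ L) ∘ ⊆L ∘ inj₁ ∘ J⊆M)
               (L⊆A ∘ proj₁ (toClosed-≐ L))
               (proj₂ (toClosed-≐ L) (⊆L (inj₂ p))))
      where
      L⊆A : ⟪ L ⟫ ⊆ _
      L⊆A p = [ J⊆A ∘ M⊆J , (λ q → proj₂ A≐ (lose K∈ q)) ]′ (L⊆ p)

    leastOf : ∀ Ks → Ks ≡ [] ⊎ ∃ (IsLeast (⋃⁺ Ks))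
    leastOf [] = inj₁ refl
    leastOf (K ∷ Ks) with leastOf Ks
    ... | inj₁ refl = inj₂ (lo K , here (lo∈ K) , λ { y (here p) → proj₁ p })
    ... | inj₂ (m , m∈ , m≤) with ≤.total m (lo K)
    ...   | inj₁ m≤l = inj₂ (m , there m∈ ,
              λ { y (here p) → ≤.trans m≤l (proj₁ p) ; y (there p) → m≤ y p })
    ...   | inj₂ l≤m = inj₂ (lo K , here (lo∈ K) ,
              λ { y (here p) → proj₁ p ; y (there p) → ≤.trans l≤m (m≤ y p) })

    Unbounded : Subset → Set ℓ
    Unbounded A = ∀ x → ∃[ y ] y ∈ A × x < y

    greatestOf : ∀ Ks → Ks ≡ [] ⊎ Unbounded (⋃⁺ Ks) ⊎ ∃ (IsGreatest (⋃⁺ Ks))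
    greatestOf [] = inj₁ refl
    greatestOf (interval i nothing tt ∷ Ks) = inj₂ (inj₁ above)
      where
      above : Unbounded (⋃⁺ (interval i nothing tt ∷ Ks))
      above x with upper i x
      ... | m , i≤m , x≤m , _ with no-right-endpoint m
      ...   | y , m<y = y , here (≤.trans i≤m (inj₁ m<y) , tt) , ≤-<-trans x≤m m<y
    greatestOf (interval i (just j) i≤j ∷ Ks) with greatestOf Ks
    ... | inj₁ refl = inj₂ (inj₂ (j , here (i≤j , ≤.refl) , λ { y (here p) → proj₂ p }))
    ... | inj₂ (inj₁ above) =
      inj₂ (inj₁ λ x → let y , y∈ , x<y = above x in y , there y∈ , x<y)
    ... | inj₂ (inj₂ (m , m∈ , ≤m)) with ≤.total m j
    ...   | inj₁ m≤j = inj₂ (inj₂ (j , here (i≤j , ≤.refl) ,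
              λ { y (here p) → proj₂ p ; y (there p) → ≤.trans (≤m y p) m≤j }))
    ...   | inj₂ j≤m = inj₂ (inj₂ (m , there m∈ ,
              λ { y (here p) → ≤.trans (proj₂ p) j≤m ; y (there p) → ≤m y p }))

    least-resp : ∀ {p q} {A : Pred Carrier p} {B : Pred Carrier q} {x} →
                 A ≐ B → IsLeast A x → IsLeast B x
    least-resp (A⊆B , B⊆A) (x∈ , x≤) = A⊆B x∈ , λ y y∈ → x≤ y (B⊆A y∈)

    greatest-resp : ∀ {p q} {A : Pred Carrier p} {B : Pred Carrier q} {x} →
                    A ≐ B → IsGreatest A x → IsGreatest B x
    greatest-resp (A⊆B , B⊆A) (x∈ , ≤x) = A⊆B x∈ , λ y y∈ → ≤x y (B⊆A y∈)

    ⋃⁺-resp : ∀ {Ks x y} → x ≈ y → x ∈ ⋃⁺ Ks → y ∈ ⋃⁺ Ks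
    ⋃⁺-resp {y = y} x≈y = Any.map λ {K} (l≤x , x≤h) →
      ≤.trans l≤x (inj₂ x≈y) , ≤⁺-trans (hi K) (inj₂ (<.Eq.sym x≈y)) x≤h

    ≐-sym : ∀ {p q} {A : Pred Carrier p} {B : Pred Carrier q} → A ≐ B → B ≐ A
    ≐-sym (f , g) = g , f

  open NormalForms

  ∅-isFci : IsFci (λ _ → ⊥)
  ∅-isFci = [] , (λ ()) , (λ ())

  Singleton-isFci : ∀ a → IsFci (Singleton a)
  Singleton-isFci a =
    toFci (singleton⁺ a ∷ [])
      ((λ { (lift x≈a) → here (singleton⁺-≐ x≈a) }) ,
       (λ { (here p) → lift (singleton⁺-≈ p) }))

  ∪-isFci : ∀ {A B} → IsFci A → IsFci B → IsFci (A ∪ B)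
  ∪-isFci (Js , A⊆ , ⊆A) (Ks , B⊆ , ⊆B) =
    Js ++ Ks ,
    (λ { (inj₁ p) → ++⁺ˡ (A⊆ p) ; (inj₂ p) → ++⁺ʳ Js (B⊆ p) }) ,
    (λ p → [ inj₁ ∘ ⊆A , inj₂ ∘ ⊆B ]′ (++⁻ Js p))

  private
    meet₁ : ∀ J Ks → ∃[ Ls ] ⋃⁺ Ls ≐ ⟪ J ⟫ ∩ ⋃⁺ Ks
    meet₁ J [] = [] , (λ ()) , (λ ())
    meet₁ J (K ∷ Ks) with intersect J K | meet₁ J Ks
    ... | inj₁ J#K | Ls , f , g =
      Ls , (λ p → proj₁ (f p) , there (proj₂ (f p))) ,
      (λ { (p , here q) → ⊥-elim (J#K _ p q) ; (p , there q) → g (p , q) })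
    ... | inj₂ (L , u , v) | Ls , f , g =
      L ∷ Ls ,
      (λ { (here p) → proj₁ (u p) , here (proj₂ (u p))
         ; (there p) → proj₁ (f p) , there (proj₂ (f p)) }) ,
      (λ { (p , here q) → here (v (p , q)) ; (p , there q) → there (g (p , q)) })

    meet : ∀ Js Ks → ∃[ Ls ] ⋃⁺ Ls ≐ ⋃⁺ Js ∩ ⋃⁺ Ks
    meet [] Ks = [] , (λ ()) , (λ { (() , _) })
    meet (J ∷ Js) Ks with meet₁ J Ks | meet Js Ks
    ... | Ls , f , g | Ms , u , v =
      Ls ++ Ms ,
      (λ p → [ (λ q → here (proj₁ (f q)) , proj₂ (f q))
             , (λ q → there (proj₁ (u q)) , proj₂ (u q)) ]′ (++⁻ Ls p)) ,
      (λ { (here p , q) → ++⁺ˡ (g (p , q)) ; (there p , q) → ++⁺ʳ Ls (v (p , q)) })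

  ∩-isFci : ∀ {A B} → IsFci A → IsFci B → IsFci (A ∩ B)
  ∩-isFci fA fB with normalForm fA | normalForm fB
  ... | Js , _ , A⊆ , ⊆A | Ks , _ , B⊆ , ⊆B with meet Js Ks
  ...   | Ls , f , g =
    toFci Ls ((λ (p , q) → g (A⊆ p , B⊆ q)) , (λ p → ⊆A (proj₁ (f p)) , ⊆B (proj₂ (f p))))

  Min-isFci : ∀ {A} → IsFci A → IsFci (Min A)
  Min-isFci fA with normalForm fA
  ... | Ks , _ , A≐ with leastOf Ks
  ...   | inj₁ refl = toFci [] ((λ (x∈ , _) → proj₁ A≐ x∈) , (λ ()))
  ...   | inj₂ (m , m-least) = toFci (singleton⁺ m ∷ []) (to , from)
    where
    to : Min _ ⊆ ⋃⁺ (singleton⁺ m ∷ [])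
    to x-least with least-resp {B = ⋃⁺ Ks} A≐ x-least
    ... | x∈ , x≤ = here (proj₂ m-least _ x∈ , x≤ m (proj₁ m-least))
    from : ⋃⁺ (singleton⁺ m ∷ []) ⊆ Min _
    from (here (m≤x , x≤m)) = least-resp (≐-sym A≐)
      (⋃⁺-resp (≤.antisym m≤x x≤m) (proj₁ m-least) ,
       λ y y∈ → ≤.trans x≤m (proj₂ m-least y y∈))

  Max-isFci : ∀ {A} → IsFci A → IsFci (Max A)
  Max-isFci fA with normalForm fA
  ... | Ks , _ , A≐ with greatestOf Ks
  ...   | inj₁ refl = toFci [] ((λ (x∈ , _) → proj₁ A≐ x∈) , (λ ()))
  ...   | inj₂ (inj₁ above) = toFci [] (none , (λ ()))
    where
    none : Max _ ⊆ ⋃⁺ []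
    none {x} (_ , ≤x) with above x
    ... | y , y∈ , x<y = ⊥-elim (<⇒≱ x<y (≤x y (proj₂ A≐ y∈)))
  ...   | inj₂ (inj₂ (m , m-greatest)) = toFci (singleton⁺ m ∷ []) (to , from)
    where
    to : Max _ ⊆ ⋃⁺ (singleton⁺ m ∷ [])
    to x-greatest with greatest-resp A≐ x-greatest
    ... | x∈ , ≤x = here (≤x m (proj₁ m-greatest) , proj₂ m-greatest _ x∈)
    from : ⋃⁺ (singleton⁺ m ∷ []) ⊆ Max _
    from (here (m≤x , x≤m)) = greatest-resp (≐-sym A≐)
      (⋃⁺-resp (≤.antisym m≤x x≤m) (proj₁ m-greatest) ,
       λ y y∈ → ≤.trans (proj₂ m-greatest y y∈) m≤x)

  LeftEnds-isFci : ∀ {A} → IsFci A → IsFci (LeftEnds A)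
  LeftEnds-isFci {A} fA with normalForm fA
  ... | Ks , nKs , A≐ = toFci (map lefts Ks) (to , from)
    where
    lefts : NonEmptyInterval → NonEmptyInterval
    lefts K = singleton⁺ (lo K)
    to : LeftEnds A ⊆ ⋃⁺ (map lefts Ks)
    to (J , J-max , J-least) with isMaximal⇒normal nKs A≐ J-max (proj₁ J-least)
    ... | K , K∈ , J≐K with least-resp J≐K J-least
    ...   | x∈ , x≤ = map⁺ (lose K∈ (proj₁ x∈ , x≤ (lo K) (lo∈ K)))
    from : ⋃⁺ (map lefts Ks) ⊆ LeftEnds A
    from {x} p with find (map⁻ p)
    ... | K , K∈ , l≤x , x≤l =
      toClosed K , normal-isMaximal nKs A≐ K∈ ,
      least-resp (≐-sym (toClosed-≐ K))
        ((l≤x , ≤⁺-trans (hi K) x≤l (nonEmpty K)) , λ y y∈ → ≤.trans x≤l (proj₁ y∈))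

  RightEnds-isFci : ∀ {A} → IsFci A → IsFci (RightEnds A)
  RightEnds-isFci {A} fA with normalForm fA
  ... | Ks , nKs , A≐ = toFci (mapMaybe right Ks) (to , from)
    where
    right : NonEmptyInterval → Maybe NonEmptyInterval
    right K = Maybe.map singleton⁺ (hi K)

    rights⁺ : ∀ {x} Ls → Any (λ K → IsGreatest ⟪ K ⟫ x) Ls → x ∈ ⋃⁺ (mapMaybe right Ls)
    rights⁺ (interval i (just j) i≤j ∷ Ls) (here (x∈ , ≤x)) =
      here (≤x j (i≤j , ≤.refl) , proj₂ x∈)
    rights⁺ {x} (interval i nothing tt ∷ Ls) (here ((i≤x , _) , ≤x)) with no-right-endpoint x
    ... | y , x<y = ⊥-elim (<⇒≱ x<y (≤x y (≤.trans i≤x (inj₁ x<y) , tt)))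
    rights⁺ (interval i (just j) i≤j ∷ Ls) (there p) = there (rights⁺ Ls p)
    rights⁺ (interval i nothing tt ∷ Ls) (there p) = rights⁺ Ls p

    rights⁻ : ∀ {x} Ls → x ∈ ⋃⁺ (mapMaybe right Ls) → Any (λ K → IsGreatest ⟪ K ⟫ x) Ls
    rights⁻ (interval i (just j) i≤j ∷ Ls) (here (j≤x , x≤j)) =
      here ((≤.trans i≤j j≤x , x≤j) , λ y y∈ → ≤.trans (proj₂ y∈) j≤x)
    rights⁻ (interval i (just j) i≤j ∷ Ls) (there p) = there (rights⁻ Ls p)
    rights⁻ (interval i nothing tt ∷ Ls) p = there (rights⁻ Ls p)

    to : RightEnds A ⊆ ⋃⁺ (mapMaybe right Ks)
    to (J , J-max , J-greatest) with isMaximal⇒normal nKs A≐ J-max (proj₁ J-greatest)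
    ... | K , K∈ , J≐K = rights⁺ Ks (lose K∈ (greatest-resp J≐K J-greatest))
    from : ⋃⁺ (mapMaybe right Ks) ⊆ RightEnds A
    from p with find (rights⁻ Ks p)
    ... | K , K∈ , K-greatest =
      toClosed K , normal-isMaximal nKs A≐ K∈ , greatest-resp (≐-sym (toClosed-≐ K)) K-greatest

  ⟦_⟧ᵗ : ∀ {n} → Term n → Vec 𝒫fci n → 𝒫fci
  ⟦ # i ⟧ᵗ    ρ = lookup ρ i
  ⟦ s ∪′ t ⟧ᵗ ρ = let A , fA = ⟦ s ⟧ᵗ ρ ; B , fB = ⟦ t ⟧ᵗ ρ in A ∪ B , ∪-isFci fA fB
  ⟦ s ∩′ t ⟧ᵗ ρ = let A , fA = ⟦ s ⟧ᵗ ρ ; B , fB = ⟦ t ⟧ᵗ ρ in A ∩ B , ∩-isFci fA fB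
  ⟦ ⊥′ ⟧ᵗ     ρ = (λ _ → ⊥) , ∅-isFci
  ⟦ c₀ ⟧ᵗ     ρ = Singleton 0# , Singleton-isFci 0#
  ⟦ min′ t ⟧ᵗ ρ = let A , fA = ⟦ t ⟧ᵗ ρ in Min A , Min-isFci fA
  ⟦ max′ t ⟧ᵗ ρ = let A , fA = ⟦ t ⟧ᵗ ρ in Max A , Max-isFci fA
  ⟦ l′ t ⟧ᵗ   ρ = let A , fA = ⟦ t ⟧ᵗ ρ in LeftEnds A , LeftEnds-isFci fA
  ⟦ r′ t ⟧ᵗ   ρ = let A , fA = ⟦ t ⟧ᵗ ρ in RightEnds A , RightEnds-isFci fA

  infix 0 _⊨_

  _⊨_ : ∀ {n} → Vec 𝒫fci n → Formula n → Set (lsuc ℓ)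
  ρ ⊨ s ≐′ t = Lift (lsuc ℓ) (proj₁ (⟦ s ⟧ᵗ ρ) ≐ proj₁ (⟦ t ⟧ᵗ ρ))
  ρ ⊨ ¬′ φ   = ¬ (ρ ⊨ φ)
  ρ ⊨ φ ∧′ ψ = (ρ ⊨ φ) × (ρ ⊨ ψ)
  ρ ⊨ φ ∨′ ψ = (ρ ⊨ φ) ⊎ (ρ ⊨ ψ)
  ρ ⊨ φ ⇒′ ψ = (ρ ⊨ φ) → (ρ ⊨ ψ)
  ρ ⊨ ∀′ φ   = (A : 𝒫fci) → A ∷ ρ ⊨ φ
  ρ ⊨ ∃′ φ   = ∃[ A ] (A ∷ ρ ⊨ φ)

{-# OPTIONS --safe #-}

-- A tuple of finite unions of closed intervals cuts the line into finitely many
-- cells [p , h), on each of which every set has one of three kinds; so the tuple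
-- is described by a finite word, unique up to subdivision of cells.  The words
-- of the tuples satisfying a formula form a regular language: the operations are
-- computed along the word, Boolean connectives are products and complements of
-- deterministic automata, and a quantifier is a projection, during which each
-- cell may be subdivided further.  That an automaton accepts is expressible by
-- an existential formula, since a run is encoded by finitely many sets, one for
-- each combination of state and letter, whose maximal intervals are cells.
module Submission where

open import Defs
open import Data.Bool.Base using (Bool; true; false; not; if_then_else_; T; _∧_)
import Data.Bool.Properties as Bool
open import Data.Empty using (⊥-elim)
open import Data.Fin.Base using (Fin; zero; suc; combine; remQuot; _↑ˡ_; _↑ʳ_)
import Data.Fin.Properties as Fin
open import Data.List.Base as List using (List; []; _∷_)
open import Data.List.Membership.Propositional using (find; lose) renaming (_∈_ to _∈ˡ_)
open import Data.List.Membership.Propositional.Properties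
  using (∈-tabulate⁺; ∈-concat⁺′; ∈-filter⁺; ∈-filter⁻; ∈-map⁺; ∈-map⁻)
open import Data.List.Properties using (filter-notAll)
open import Data.List.Relation.Unary.All as All using (All; []; _∷_)
import Data.List.Relation.Unary.All.Properties as All
open import Data.List.Relation.Unary.AllPairs using (AllPairs; []; _∷_)
import Data.List.Relation.Unary.AllPairs.Properties as AllPairs
open import Data.List.Relation.Unary.Any as Any using (Any; here; there)
open import Data.Maybe.Base using (Maybe; just; nothing)
open import Data.Nat.Base as ℕ using (ℕ; zero; suc; _+_; _*_)
open import Data.Nat.Induction using (<-wellFounded)
open import Data.Product using (∃; ∃-syntax; ∃₂; _×_; _,_; proj₁; proj₂)
open import Data.Sum.Base using (_⊎_; inj₁; inj₂; [_,_]′)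
open import Data.Unit.Base using (⊤; tt)
import Data.Unit.Polymorphic.Base as Polymorphic
open import Data.Vec.Base as Vec using (Vec; []; _∷_; lookup; map; tabulate; head; tail)
open import Data.Vec.Properties
  using (lookup∘tabulate; tabulate∘lookup; lookup-map; lookup-++ˡ; lookup-++ʳ)
open import Function.Base using (_∘_; id; flip)
open import Function.Bundles using (_⇔_; mk⇔; Equivalence)
open import Induction.WellFounded using (Acc) renaming (acc to access)
open import Level using (_⊔_; Lift; lift) renaming (suc to lsuc)
open import Relation.Binary.Construct.Closure.ReflexiveTransitive using (Star; ε; _◅_; _◅◅_)
open import Relation.Binary.Definitions using (DecidableEquality) renaming (Decidable to Decidable₂)
open import Relation.Binary.PropositionalEquality
  using (_≡_; _≢_; refl; sym; trans; cong; cong₂; subst)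
open import Relation.Nullary using (¬_; Dec; yes; no)
open import Relation.Nullary.Decidable
  using (map′; isYes; toWitness; fromWitness; decidable-stable; _×-dec_; _⊎-dec_; _→-dec_; ¬?)
open import Relation.Unary using (_∈_; _≐_; _∪_; _∩_; Decidable)

open Equivalence using (to; from)

-- Existential formulas are not visibly closed under negation, so the induction runs over automata,
-- where negation is complementation; only the finished automaton is turned back into a formula. For
-- this, acceptance must not depend on how the cells are cut: `Recognizable` demands the equivalence
-- on every grid that fits the tuple. The run formula then asserts only that some grid carries an
-- accepted word, which is existential and, by that demand, equivalent to the same assertion for all
-- grids. Cells are half-open on the right because the sets are closed: a right endpoint becomes the
-- left end of a cell of kind `end`, so three kinds suffice. The price is a link between neighbours,
-- `Closed`: after `on` the next kind is not `out`. The argument is constructive: trichotomy and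
-- finite automata make truth decidable, and this justifies reducing the other connectives to
-- negation, conjunction and projection.

-- Finite types and reachability in finite graphs.

record Enumeration (A : Set) : Set where
  field
    size          : ℕ
    decode        : Fin size → A
    encode        : A → Fin size
    -- A retraction is enough for deciding equality and for exhaustive search; `decode` may list an
    -- element more than once.
    decode-encode : ∀ x → decode (encode x) ≡ x

  _≟_ : DecidableEquality A
  x ≟ y = map′
    (λ eq → trans (sym (decode-encode x)) (trans (cong decode eq) (decode-encode y)))
    (cong encode) (encode x Fin.≟ encode y)

  any? : ∀ {p} {P : A → Set p} → Decidable P → Dec (∃ P)
  any? {P = P} P? = map′
    (λ (i , p) → decode i , p)
    (λ (x , p) → encode x , subst P (sym (decode-encode x)) p)
    (Fin.any? (P? ∘ decode))

  elements : List A
  elements = List.tabulate decode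

  ∈-elements : ∀ x → x ∈ˡ elements
  ∈-elements x = subst (_∈ˡ elements) (decode-encode x) (∈-tabulate⁺ (encode x))

open Enumeration

Fin-enumeration : ∀ n → Enumeration (Fin n)
Fin-enumeration n = record
  { size = n ; decode = id ; encode = id ; decode-encode = λ _ → refl }

retract : ∀ {A B} → Enumeration A → (f : A → B) (g : B → A) → (∀ y → f (g y) ≡ y) → Enumeration B
retract A f g fg = record
  { size          = size A
  ; decode        = f ∘ decode A
  ; encode        = encode A ∘ g
  ; decode-encode = λ y → trans (cong f (decode-encode A (g y))) (fg y)
  }

Bool-enumeration : Enumeration Bool
Bool-enumeration = retract (Fin-enumeration 2)
  (λ { zero → false ; (suc zero) → true })
  (λ { false → zero ; true → suc zero })
  (λ { false → refl ; true → refl })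

Maybe-enumeration : ∀ {A} → Enumeration A → Enumeration (Maybe A)
Maybe-enumeration A = record
  { size          = suc (size A)
  ; decode        = λ { zero → nothing ; (suc i) → just (decode A i) }
  ; encode        = λ { nothing → zero ; (just x) → suc (encode A x) }
  ; decode-encode = λ { nothing → refl ; (just x) → cong just (decode-encode A x) }
  }

×-enumeration : ∀ {A B} → Enumeration A → Enumeration B → Enumeration (A × B)
×-enumeration A B = record
  { size          = size A * size B
  ; decode        = λ i → let j , k = remQuot (size B) i in decode A j , decode B k
  ; encode        = λ (x , y) → combine (encode A x) (encode B y)
  ; decode-encode = λ (x , y) → trans
      (cong (λ (j , k) → decode A j , decode B k) (Fin.remQuot-combine (encode A x) (encode B y)))
      (cong₂ _,_ (decode-encode A x) (decode-encode B y))
  }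

Vec-enumeration : ∀ {A} → Enumeration A → ∀ n → Enumeration (Vec A n)
Vec-enumeration A zero    = retract (Fin-enumeration 1) (λ _ → []) (λ _ → zero) (λ { [] → refl })
Vec-enumeration A (suc n) = retract (×-enumeration A (Vec-enumeration A n))
  (λ (x , xs) → x ∷ xs) (λ { (x ∷ xs) → x , xs }) (λ { (x ∷ xs) → refl })

-- Warshall's algorithm: a path decomposes along its visits to each vertex.
module Reachability {A : Set} (A-enum : Enumeration A)
                    {R : A → A → Set} (R? : Decidable₂ R) where

  Via : List A → A → A → Set
  Via []       x y = x ≡ y ⊎ R x y
  Via (v ∷ vs) x y = Via vs x y ⊎ (Via vs x v × Via vs v y)

  via? : ∀ vs → Decidable₂ (Via vs)
  via? []       x y = _≟_ A-enum x y ⊎-dec R? x y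
  via? (v ∷ vs) x y = via? vs x y ⊎-dec (via? vs x v ×-dec via? vs v y)

  via⇒star : ∀ vs {x y} → Via vs x y → Star R x y
  via⇒star []       (inj₁ refl)    = ε
  via⇒star []       (inj₂ r)       = r ◅ ε
  via⇒star (v ∷ vs) (inj₁ p)       = via⇒star vs p
  via⇒star (v ∷ vs) (inj₂ (p , q)) = via⇒star vs p ◅◅ via⇒star vs q

  via-base : ∀ vs {x y} → x ≡ y ⊎ R x y → Via vs x y
  via-base []       p = p
  via-base (v ∷ vs) p = inj₁ (via-base vs p)

  -- Two paths glued at `v` may visit a vertex of the list repeatedly. What lies between the first
  -- and the last visit to the head of the list is cut out, and the induction continues on the tail.
  via-trans : ∀ {vs v x y} → v ∈ˡ vs → Via vs x v → Via vs v y → Via vs x y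
  via-trans (here refl) p q = inj₂ (into p , outOf q)
    where
    into : ∀ {v vs x} → Via (v ∷ vs) x v → Via vs x v
    into (inj₁ p)       = p
    into (inj₂ (p , _)) = p
    outOf : ∀ {v vs y} → Via (v ∷ vs) v y → Via vs v y
    outOf (inj₁ q)       = q
    outOf (inj₂ (_ , q)) = q
  via-trans (there v∈) (inj₁ p)       (inj₁ q)       = inj₁ (via-trans v∈ p q)
  via-trans (there v∈) (inj₁ p)       (inj₂ (q , r)) = inj₂ (via-trans v∈ p q , r)
  via-trans (there v∈) (inj₂ (p , q)) (inj₁ r)       = inj₂ (p , via-trans v∈ q r)
  via-trans (there v∈) (inj₂ (p , _)) (inj₂ (_ , q)) = inj₂ (p , q)

  star⇒via : ∀ {x y} → Star R x y → Via (elements A-enum) x y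
  star⇒via ε        = via-base (elements A-enum) (inj₁ refl)
  star⇒via (r ◅ rs) =
    via-trans (∈-elements A-enum _) (via-base (elements A-enum) (inj₂ r)) (star⇒via rs)

  star? : Decidable₂ (Star R)
  star? x y = map′ (via⇒star (elements A-enum)) star⇒via (via? (elements A-enum) x y)

-- Kinds, words and subdivision.

-- The kind of a set on a cell [p , h): disjoint from the cell, meeting it in
-- p only, or containing the closed interval [p , h].
data Kind : Set where
  out end on : Kind

Kind-enumeration : Enumeration Kind
Kind-enumeration = retract (Fin-enumeration 3)
  (λ { zero → out ; (suc zero) → end ; (suc (suc zero)) → on })
  (λ { out → zero ; end → suc zero ; on → suc (suc zero) })
  (λ { out → refl ; end → refl ; on → refl })

_≟ᵏ_ : DecidableEquality Kind
_≟ᵏ_ = _≟_ Kind-enumeration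

-- The kind on [x , h) for p < x < h of a set of the given kind on [p , h).
stay : Kind → Kind
stay out = out
stay end = out
stay on  = on

isOn : Kind → Bool
isOn on = true
isOn _  = false

Letter : ℕ → Set
Letter n = Vec Kind n

Word : ℕ → ℕ → Set
Word n m = Vec (Letter n) m

column : ∀ {n m} → Fin n → Word n m → Vec Kind m
column i = map (flip lookup i)

column-tail : ∀ {n m} (i : Fin n) (w : Word (suc n) m) → column i (map tail w) ≡ column (suc i) w
column-tail i []            = refl
column-tail i ((_ ∷ _) ∷ w) = cong (_ ∷_) (column-tail i w)

infix 4 _⊴_

-- w ⊴ w′ when w′ arises from w by subdividing cells.
data _⊴_ {n} : ∀ {m m′} → Word n m → Word n m′ → Set where
  done   : [] ⊴ []
  next   : ∀ {a m m′} {w : Word n m} {w′ : Word n m′} → w ⊴ w′ → a ∷ w ⊴ a ∷ w′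
  repeat : ∀ {a m m′} {w : Word n m} {w′ : Word n m′} → map stay a ∷ w ⊴ w′ → a ∷ w ⊴ a ∷ w′

stay-idem : ∀ {n} (a : Letter n) → map stay (map stay a) ≡ map stay a
stay-idem []        = refl
stay-idem (out ∷ a) = cong (out ∷_) (stay-idem a)
stay-idem (end ∷ a) = cong (out ∷_) (stay-idem a)
stay-idem (on ∷ a)  = cong (on ∷_) (stay-idem a)

⊴-refl : ∀ {n m} {w : Word n m} → w ⊴ w
⊴-refl {w = []}    = done
⊴-refl {w = a ∷ w} = next ⊴-refl

-- `stay` is idempotent, so what remains of a cut cell keeps its letter when it is cut again. This
-- is the case of `⊴-trans` in which both subdivisions cut the same cell.
⊴-stay : ∀ {n m m′} {a : Letter n} {w : Word n m} {w′ : Word n m′} →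
         map stay a ∷ w ⊴ w′ → map stay a ∷ w ⊴ map stay a ∷ w′
⊴-stay {a = a} {w} r = repeat (subst (λ b → b ∷ w ⊴ _) (sym (stay-idem a)) r)

⊴-trans : ∀ {n k l m} {u : Word n k} {v : Word n l} {w : Word n m} → u ⊴ v → v ⊴ w → u ⊴ w
⊴-trans done       done       = done
⊴-trans (next r)   (next s)   = next (⊴-trans r s)
⊴-trans (next r)   (repeat s) = repeat (⊴-trans (next r) s)
⊴-trans (repeat r) (next s)   = repeat (⊴-trans r s)
⊴-trans (repeat r) (repeat s) = repeat (⊴-trans (⊴-stay r) s)

-- The previous cell being of kind on, its right end belongs to the set.
Allowed : Bool → Kind → Set
Allowed o k = T o → k ≢ out

Allowed? : ∀ o k → Dec (Allowed o k)
Allowed? o k = Bool.T? o →-dec ¬? (k ≟ᵏ out)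

-- This characterises the tracks that come from finite unions of closed intervals: `labels-closed`
-- gives necessity, `realise` sufficiency.
Closed : ∀ {m} → Bool → Vec Kind m → Set
Closed o []       = ⊤
Closed o (k ∷ ks) = Allowed o k × Closed (isOn k) ks

-- Finite automata: complement, product, relabelling, determinisation, projection.

record DFA (n : ℕ) : Set₁ where
  field
    State  : Set
    states : Enumeration State
    start  : State
    δ      : State → Letter n → State
    final  : State → Bool

  accepts : ∀ {m} → State → Word n m → Bool
  accepts s []      = final s
  accepts s (a ∷ w) = accepts (δ s a) w

  Accepts : ∀ {m} → Word n m → Set
  Accepts w = T (accepts start w)

complement : ∀ {n} → DFA n → DFA n
complement D = record { DFA D ; final = not ∘ DFA.final D }

complement-accepts : ∀ {n m} (D : DFA n) (w : Word n m) →
                     (¬ DFA.Accepts D w) ⇔ DFA.Accepts (complement D) w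
complement-accepts D w = go _ w
  where
  T-not : ∀ b → (¬ T b) ⇔ T (not b)
  T-not false = mk⇔ _ (λ _ ())
  T-not true  = mk⇔ (λ f → f tt) (λ ())
  go : ∀ {m} s (w : Word _ m) →
       (¬ T (DFA.accepts D s w)) ⇔ T (DFA.accepts (complement D) s w)
  go s []      = T-not _
  go s (a ∷ w) = go (DFA.δ D s a) w

product : ∀ {n} → DFA n → DFA n → DFA n
product D E = record
  { State  = D.State × E.State
  ; states = ×-enumeration D.states E.states
  ; start  = D.start , E.start
  ; δ      = λ (s , t) a → D.δ s a , E.δ t a
  ; final  = λ (s , t) → D.final s ∧ E.final t
  }
  where module D = DFA D ; module E = DFA E

product-accepts : ∀ {n m} (D E : DFA n) (w : Word n m) →
                  (DFA.Accepts D w × DFA.Accepts E w) ⇔ DFA.Accepts (product D E) w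
product-accepts D E w = go _ _ w
  where
  go : ∀ {m} s t (w : Word _ m) → (T (DFA.accepts D s w) × T (DFA.accepts E t w)) ⇔
                                  T (DFA.accepts (product D E) (s , t) w)
  go s t []      = mk⇔ (from Bool.T-∧) (to Bool.T-∧)
  go s t (a ∷ w) = go (DFA.δ D s a) (DFA.δ E t a) w

relabel : ∀ {n k} → (Letter n → Letter k) → DFA k → DFA n
relabel f D = record { DFA D ; δ = λ s a → DFA.δ D s (f a) }

relabel-accepts : ∀ {n k m} (f : Letter n → Letter k) (D : DFA k) (w : Word n m) →
                  DFA.Accepts D (map f w) ⇔ DFA.Accepts (relabel f D) w
relabel-accepts f D w = go _ w
  where
  go : ∀ {m} s (w : Word _ m) →
       T (DFA.accepts D s (map f w)) ⇔ T (DFA.accepts (relabel f D) s w)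
  go s []      = mk⇔ id id
  go s (a ∷ w) = go (DFA.δ D s (f a)) w

record NFA (n : ℕ) : Set₁ where
  field
    State  : Set
    states : Enumeration State
    start  : State
    Δ      : Letter n → State → State → Set
    Δ?     : ∀ a → Decidable₂ (Δ a)
    final  : State → Bool

  Path : ∀ {m} → State → Word n m → Set
  Path s []      = T (final s)
  Path s (a ∷ w) = ∃[ t ] Δ a s t × Path t w

-- The subset construction, carried out on indices instead of states, so that a subset is a bit
-- vector and the new states are again enumerated.
module Determinise {n} (N : NFA n) where
  open NFA N
  private module S = Enumeration states

  characteristic : {P : Fin S.size → Set} → Decidable P → Vec Bool S.size
  characteristic P? = tabulate (isYes ∘ P?)

  ∈-characteristic : ∀ {P : Fin S.size → Set} (P? : Decidable P) i →
                     T (lookup (characteristic P?) i) ⇔ P i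
  ∈-characteristic P? i rewrite lookup∘tabulate (isYes ∘ P?) i =
    mk⇔ (toWitness {a? = P? i}) (fromWitness {a? = P? i})

  Successor : Letter n → Vec Bool S.size → Fin S.size → Set
  Successor a V j = ∃[ i ] T (lookup V i) × Δ a (S.decode i) (S.decode j)

  successor? : ∀ a V → Decidable (Successor a V)
  successor? a V j = Fin.any? λ i → Bool.T? (lookup V i) ×-dec Δ? a (S.decode i) (S.decode j)

  Final : Vec Bool S.size → Set
  Final V = ∃[ i ] T (lookup V i) × T (final (S.decode i))

  final? : Decidable Final
  final? V = Fin.any? λ i → Bool.T? (lookup V i) ×-dec Bool.T? (final (S.decode i))

  determinise : DFA n
  determinise = record
    { State  = Vec Bool S.size
    ; states = Vec-enumeration Bool-enumeration S.size
    ; start  = characteristic (S.encode start Fin.≟_)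
    ; δ      = λ V a → characteristic (successor? a V)
    ; final  = isYes ∘ final?
    }

  accepts⇔ : ∀ {m} V (w : Word n m) →
             (∃[ i ] T (lookup V i) × Path (S.decode i) w) ⇔ T (DFA.accepts determinise V w)
  accepts⇔ V []      = mk⇔ (fromWitness {a? = final? V}) (toWitness {a? = final? V})
  accepts⇔ V (a ∷ w) = mk⇔
    (λ (i , i∈ , t , r , p) → to IH
       ( S.encode t
       , from (∈-characteristic (successor? a V) _)
           (i , i∈ , subst (Δ a _) (sym (S.decode-encode t)) r)
       , subst (λ t → Path t w) (sym (S.decode-encode t)) p))
    (λ acc → let j , j∈ , p = from IH acc
                 i , i∈ , r = to (∈-characteristic (successor? a V) j) j∈
             in i , i∈ , S.decode j , r , p)
    where
    IH : (∃[ i ] T (lookup (characteristic (successor? a V)) i) × Path (S.decode i) w) ⇔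
         T (DFA.accepts determinise (characteristic (successor? a V)) w)
    IH = accepts⇔ (characteristic (successor? a V)) w

  determinise-accepts : ∀ {m} (w : Word n m) → Path start w ⇔ DFA.Accepts determinise w
  determinise-accepts w = mk⇔
    (λ p → to (accepts⇔ _ w)
      ( S.encode start
      , from (∈-characteristic (S.encode start Fin.≟_) _) refl
      , subst (λ s → Path s w) (sym (S.decode-encode start)) p))
    (λ acc → let i , i∈ , p = from (accepts⇔ _ w) acc
                 eq = to (∈-characteristic (S.encode start Fin.≟_) i) i∈
             in subst (λ s → Path s w)
                  (trans (cong S.decode (sym eq)) (S.decode-encode start)) p)

-- Projection along the first track: a set quantified over may have more
-- endpoints than the parameters, so the nondeterministic automaton reads one
-- letter as an arbitrary subdivision of its cell.
module Projection {n} (D : DFA (suc n)) where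
  open DFA D

  -- The bit records whether the kind guessed for the previous piece is `on`; with it the automaton
  -- guesses only `Closed` tracks, that is, tracks of actual sets.
  Config : Set
  Config = State × Bool

  configs : Enumeration Config
  configs = ×-enumeration states Bool-enumeration

  Step : Letter n → Config → Config → Set
  Step a (s , o) c = ∃[ k ] Allowed o k × c ≡ (δ s (k ∷ a) , isOn k)

  step? : ∀ a → Decidable₂ (Step a)
  step? a (s , o) c = any? Kind-enumeration λ k →
    Allowed? o k ×-dec _≟_ configs c (δ s (k ∷ a) , isOn k)

  -- Only the first piece of a cut cell contains its left end and reads `a`; all later ones read
  -- `map stay a`. Their number is unbounded, which is why reachability has to be decided.
  Pass : Letter n → Config → Config → Set
  Pass a c d = ∃[ c′ ] Step a c c′ × Star (Step (map stay a)) c′ d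

  pass? : ∀ a → Decidable₂ (Pass a)
  pass? a c d = any? configs λ c′ →
    step? a c c′ ×-dec Reachability.star? configs (step? (map stay a)) c′ d

  nfa : NFA n
  nfa = record
    { State = Config ; states = configs ; start = start , false
    ; Δ = Pass ; Δ? = pass? ; final = final ∘ proj₁ }

  open NFA nfa using (Path)

  Extends : ∀ {m} → Config → Word n m → Set
  Extends (s , o) w = ∃[ m′ ] ∃[ w′ ]
    w ⊴ map tail w′ × Closed o (column {m = m′} zero w′) × T (accepts s w′)

  -- The letter `b` of the star is kept apart from `a`: in the induction the first step too comes to
  -- read `map stay a`, and idempotence of `stay` restores the hypothesis.
  extend : ∀ {m} {a b : Letter n} {w : Word n m} {c c′ d} → b ≡ map stay a →
           Step a c c′ → Star (Step b) c′ d → Extends d w → Extends c (a ∷ w)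
  extend {a = a} _ (k , ok , refl) ε (m , w′ , r , cl , acc) =
    suc m , (k ∷ a) ∷ w′ , next r , (ok , cl) , acc
  extend {a = a} refl (k , ok , refl) (μ ◅ μs) E with extend (sym (stay-idem a)) μ μs E
  ... | m , w′ , r , cl , acc = suc m , (k ∷ a) ∷ w′ , repeat r , (ok , cl) , acc

  path⇒extends : ∀ {m} c (w : Word n m) → Path c w → Extends c w
  path⇒extends c []      acc                    = 0 , [] , done , tt , acc
  path⇒extends c (a ∷ w) (d , (_ , μ , μs) , p) = extend refl μ μs (path⇒extends d w p)

  extends⇒path : ∀ {m m′} {w : Word n m} s o (w′ : Word (suc n) m′) →
                 w ⊴ map tail w′ → Closed o (column zero w′) → T (accepts s w′) → Path (s , o) w
  extends⇒path s o [] done _ acc = acc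
  extends⇒path s o ((k ∷ a) ∷ w′) (next r) (ok , cl) acc =
    _ , (_ , (k , ok , refl) , ε) , extends⇒path _ _ w′ r cl acc
  extends⇒path s o ((k ∷ a) ∷ w′) (repeat r) (ok , cl) acc
    with extends⇒path _ _ w′ r cl acc
  -- The path for the remainder opens with a pass over `map stay a`. The present step goes in front,
  -- and that whole pass becomes its star.
  ... | d , (_ , μ , μs) , p = d , (_ , (k , ok , refl) , μ ◅ μs′) , p
    where
    μs′ : Star (Step (map stay a)) _ d
    μs′ = subst (λ b → Star (Step b) _ d) (stay-idem a) μs

  projection : DFA n
  projection = Determinise.determinise nfa

  projection-accepts : ∀ {m} (w : Word n m) → Extends (start , false) w ⇔ DFA.Accepts projection w
  projection-accepts w = mk⇔
    (λ (_ , w′ , r , cl , acc) →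
       to (Determinise.determinise-accepts nfa w) (extends⇒path _ _ w′ r cl acc))
    (λ acc → path⇒extends _ w (from (Determinise.determinise-accepts nfa w) acc))

-- Operations on tracks and automata for their graphs.

-- Every operation is treated as binary, constants and unary ones ignoring arguments, so that a
-- single format of graph on three tracks serves them all.
Transducer : Set
Transducer = ∀ {m} → Vec Kind m → Vec Kind m → Vec Kind m

record Graph (F : Transducer) : Set₁ where
  field
    dfa     : DFA 3
    correct : ∀ {m} (w : Word 3 m) →
      column zero w ≡ F (column (suc zero) w) (column (suc (suc zero)) w) ⇔ DFA.Accepts dfa w

∷-≡⇔ : ∀ {m} {k k′ : Kind} {ks ks′ : Vec Kind m} → (k ≡ k′ × ks ≡ ks′) ⇔ k ∷ ks ≡ k′ ∷ ks′
∷-≡⇔ = mk⇔ (λ { (refl , refl) → refl }) (λ { refl → refl , refl })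

-- These are the operations whose value on a cell depends on the kinds there and on one bit about
-- what lies to the left. Only `max` looks to the right and needs an automaton of its own.
module Sequential (initial : Bool) (output : Bool → Kind → Kind → Kind)
                  (following : Bool → Kind → Kind → Bool) where

  run : Bool → Transducer
  run s []       []       = []
  run s (k ∷ ks) (l ∷ ls) = output s k l ∷ run (following s k l) ks ls

  private
    step : Maybe Bool → Letter 3 → Maybe Bool
    step nothing  _                = nothing
    step (just s) (z ∷ k ∷ l ∷ []) with z ≟ᵏ output s k l
    ... | yes _ = just (following s k l)
    ... | no  _ = nothing

    graph : DFA 3
    graph = record
      { State = Maybe Bool ; states = Maybe-enumeration Bool-enumeration ; start = just initial
      ; δ = step ; final = λ { nothing → false ; (just _) → true } }

    dead : ∀ {m} (w : Word 3 m) → ¬ T (DFA.accepts graph nothing w)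
    dead (a ∷ w) = dead w

    graph-correct : ∀ {m} s (w : Word 3 m) →
      column zero w ≡ run s (column (suc zero) w) (column (suc (suc zero)) w) ⇔
      T (DFA.accepts graph (just s) w)
    graph-correct s [] = mk⇔ _ (λ _ → refl)
    graph-correct s ((z ∷ k ∷ l ∷ []) ∷ w) with z ≟ᵏ output s k l
    ... | yes refl = mk⇔ (to IH ∘ proj₂ ∘ from ∷-≡⇔) (λ acc → cong (z ∷_) (from IH acc))
      where IH = graph-correct (following s k l) w
    ... | no  z≢   = mk⇔ (⊥-elim ∘ z≢ ∘ proj₁ ∘ from ∷-≡⇔) (⊥-elim ∘ dead w)

  sequential-graph : Graph (run initial)
  sequential-graph = record { dfa = graph ; correct = graph-correct initial }

allOut : ∀ {m} → Vec Kind m → Bool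
allOut []         = true
allOut (out ∷ ks) = allOut ks
allOut (end ∷ ks) = false
allOut (on  ∷ ks) = false

-- Only a cell of kind `end` can contain the maximum: in a cell of kind `on` no point is greatest,
-- and its right end is already the left end of the next cell.
lastEnd : Kind → Bool → Kind
lastEnd end true = end
lastEnd _   _    = out

maxRun : Transducer
maxRun []       []       = []
maxRun (k ∷ ks) (_ ∷ ls) = lastEnd k (allOut ks) ∷ maxRun ks ls

-- A state just r records in r what allOut, if anything, is required to be on
-- the rest of the word.
module MaxGraph where

  -- The maximum depends on the future, but the claimed output supplies the guess: `out` over `end`
  -- promises later points, `end` over `end` promises none. Checking the promise is deterministic.
  step : Maybe (Maybe Bool) → Letter 3 → Maybe (Maybe Bool)
  step (just r)           (out ∷ out ∷ _ ∷ []) = just r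
  step (just (just true)) _                    = nothing
  step (just _)           (out ∷ end ∷ _ ∷ []) = just (just false)
  step (just _)           (end ∷ end ∷ _ ∷ []) = just (just true)
  step (just _)           (out ∷ on  ∷ _ ∷ []) = just nothing
  step _                  _                    = nothing

  graph : DFA 3
  graph = record
    { State = Maybe (Maybe Bool)
    ; states = Maybe-enumeration (Maybe-enumeration Bool-enumeration)
    ; start = just nothing
    ; δ = step
    ; final = λ { nothing → false ; (just nothing) → true ; (just (just b)) → b } }

  Required : Maybe Bool → Bool → Set
  Required nothing  _ = ⊤
  Required (just b) c = c ≡ b

  Spec : ∀ {m} → Maybe Bool → Word 3 m → Set
  Spec r w = Required r (allOut xs) × column zero w ≡ maxRun xs (column (suc (suc zero)) w)
    where xs = column (suc zero) w

  dead : ∀ {m} (w : Word 3 m) → ¬ T (DFA.accepts graph nothing w)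
  dead (a ∷ w) = dead w

  reject : ∀ {p m} {P : Set p} (w : Word 3 m) → ¬ P → P ⇔ T (DFA.accepts graph nothing w)
  reject w ¬p = mk⇔ (⊥-elim ∘ ¬p) (⊥-elim ∘ dead w)

  -- The common shape of all transitions that do not reject: the two hypotheses say that `r` before
  -- the letter, together with a correct output, amounts to `r′` after it.
  descend : ∀ {m} r r′ z x y (w : Word 3 m) →
    (Required r (allOut (x ∷ column (suc zero) w)) →
     z ≡ lastEnd x (allOut (column (suc zero) w)) → Required r′ (allOut (column (suc zero) w))) →
    (Required r′ (allOut (column (suc zero) w)) →
     Required r (allOut (x ∷ column (suc zero) w)) ×
     z ≡ lastEnd x (allOut (column (suc zero) w))) →
    Spec r′ w ⇔ T (DFA.accepts graph (just r′) w) →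
    Spec r ((z ∷ x ∷ y ∷ []) ∷ w) ⇔ T (DFA.accepts graph (just r′) w)
  descend _ _ _ _ _ w f g IH = mk⇔
    (λ (q , e) → let z≡ , zs≡ = from ∷-≡⇔ e in to IH (f q z≡ , zs≡))
    (λ acc → let q , zs≡ = from IH acc ; q′ , z≡ = g q in q′ , to ∷-≡⇔ (z≡ , zs≡))

  lastEnd-out : ∀ {b} → out ≡ lastEnd end b → b ≡ false
  lastEnd-out {false} _ = refl

  lastEnd-end : ∀ {b} → end ≡ lastEnd end b → b ≡ true
  lastEnd-end {true} _ = refl

  lastEnd-on : ∀ {b} → on ≢ lastEnd end b
  lastEnd-on {false} ()
  lastEnd-on {true}  ()

  correct : ∀ {m} r (w : Word 3 m) → Spec r w ⇔ T (DFA.accepts graph (just r) w)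
  correct nothing      []                          = mk⇔ _ (λ _ → tt , refl)
  correct (just true)  []                          = mk⇔ _ (λ _ → refl , refl)
  correct (just false) []                          = mk⇔ (λ { (() , _) }) λ ()
  correct r            ((out ∷ out ∷ y ∷ []) ∷ w)  =
    descend r r out out y w (λ q _ → q) (_, refl) (correct r w)
  correct nothing      ((end ∷ out ∷ _ ∷ []) ∷ w)  = reject w λ { (_ , ()) }
  correct (just false) ((end ∷ out ∷ _ ∷ []) ∷ w)  = reject w λ { (_ , ()) }
  correct (just true)  ((end ∷ out ∷ _ ∷ []) ∷ w)  = reject w λ { (_ , ()) }
  correct nothing      ((on  ∷ out ∷ _ ∷ []) ∷ w)  = reject w λ { (_ , ()) }
  correct (just false) ((on  ∷ out ∷ _ ∷ []) ∷ w)  = reject w λ { (_ , ()) }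
  correct (just true)  ((on  ∷ out ∷ _ ∷ []) ∷ w)  = reject w λ { (_ , ()) }
  correct (just true)  ((out ∷ end ∷ _ ∷ []) ∷ w)  = reject w λ { (() , _) }
  correct (just true)  ((end ∷ end ∷ _ ∷ []) ∷ w)  = reject w λ { (() , _) }
  correct (just true)  ((on  ∷ end ∷ _ ∷ []) ∷ w)  = reject w λ { (() , _) }
  correct (just true)  ((out ∷ on  ∷ _ ∷ []) ∷ w)  = reject w λ { (() , _) }
  correct (just true)  ((end ∷ on  ∷ _ ∷ []) ∷ w)  = reject w λ { (() , _) }
  correct (just true)  ((on  ∷ on  ∷ _ ∷ []) ∷ w)  = reject w λ { (() , _) }
  correct nothing      ((out ∷ end ∷ y ∷ []) ∷ w)  =
    descend nothing (just false) out end y w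
      (λ _ → lastEnd-out) (λ b≡ → tt , cong (lastEnd end) (sym b≡)) (correct (just false) w)
  correct (just false) ((out ∷ end ∷ y ∷ []) ∷ w)  =
    descend (just false) (just false) out end y w
      (λ _ → lastEnd-out) (λ b≡ → refl , cong (lastEnd end) (sym b≡)) (correct (just false) w)
  correct nothing      ((end ∷ end ∷ y ∷ []) ∷ w)  =
    descend nothing (just true) end end y w
      (λ _ → lastEnd-end) (λ b≡ → tt , cong (lastEnd end) (sym b≡)) (correct (just true) w)
  correct (just false) ((end ∷ end ∷ y ∷ []) ∷ w)  =
    descend (just false) (just true) end end y w
      (λ _ → lastEnd-end) (λ b≡ → refl , cong (lastEnd end) (sym b≡)) (correct (just true) w)
  correct nothing      ((on  ∷ end ∷ _ ∷ []) ∷ w)  =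
    reject w (lastEnd-on ∘ proj₁ ∘ from ∷-≡⇔ ∘ proj₂)
  correct (just false) ((on  ∷ end ∷ _ ∷ []) ∷ w)  =
    reject w (lastEnd-on ∘ proj₁ ∘ from ∷-≡⇔ ∘ proj₂)
  correct nothing      ((out ∷ on  ∷ y ∷ []) ∷ w)  =
    descend nothing nothing out on y w _ (λ _ → tt , refl) (correct nothing w)
  correct (just false) ((out ∷ on  ∷ y ∷ []) ∷ w)  =
    descend (just false) nothing out on y w _ (λ _ → refl , refl) (correct nothing w)
  correct nothing      ((end ∷ on  ∷ _ ∷ []) ∷ w)  = reject w λ { (_ , ()) }
  correct (just false) ((end ∷ on  ∷ _ ∷ []) ∷ w)  = reject w λ { (_ , ()) }
  correct nothing      ((on  ∷ on  ∷ _ ∷ []) ∷ w)  = reject w λ { (_ , ()) }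
  correct (just false) ((on  ∷ on  ∷ _ ∷ []) ∷ w)  = reject w λ { (_ , ()) }

max-graph : Graph maxRun
max-graph = record
  { dfa     = MaxGraph.graph
  ; correct = λ w → mk⇔ (λ e → to (MaxGraph.correct nothing w) (tt , e))
                        (proj₂ ∘ from (MaxGraph.correct nothing w))
  }

module ModelCompleteness {c ℓ₁ ℓ₂} (I : LeftClosedDenseLinearOrder c ℓ₁ ℓ₂) where

  open LeftClosedDenseLinearOrder I
  open 𝓛 I
  open NormalForms

  -- Order lemmas and a local description of endpoints.

  infix 4 _<⁺_

  _<⁺_ : Carrier → Maybe Carrier → Set ℓ₂
  x <⁺ just b  = x < b
  x <⁺ nothing = Polymorphic.⊤

  <-≤-trans : ∀ {x y z} → x < y → y ≤ z → x < z
  <-≤-trans x<y (inj₁ y<z) = <.trans x<y y<z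
  <-≤-trans x<y (inj₂ y≈z) = <.<-respʳ-≈ y≈z x<y

  ≤-<⁺-trans : ∀ {x y} h → x ≤ y → y <⁺ h → x <⁺ h
  ≤-<⁺-trans (just b) x≤y y<b = ≤-<-trans x≤y y<b
  ≤-<⁺-trans nothing  _   _   = _

  <⁺⇒≤⁺ : ∀ {x} h → x <⁺ h → x ≤⁺ h
  <⁺⇒≤⁺ (just b) x<b = inj₁ x<b
  <⁺⇒≤⁺ nothing  _   = _

  between : ∀ {p} h → p <⁺ h → ∃[ x ] p < x × x <⁺ h
  between     (just b) p<b = dense p<b
  between {p} nothing  _   = let x , p<x = no-right-endpoint p in x , p<x , _

  ≤-split : ∀ {p x} → p ≤ x → x ≈ p ⊎ p < x
  ≤-split (inj₁ p<x) = inj₂ p<x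
  ≤-split (inj₂ p≈x) = inj₁ (<.Eq.sym p≈x)

  fci-resp : ∀ {A} → IsFci A → ∀ {x y} → x ≈ y → x ∈ A → y ∈ A
  fci-resp fA x≈y x∈A with normalForm fA
  ... | Ks , _ , A⊆ , ⊆A = ⊆A (⋃⁺-resp {Ks} x≈y (A⊆ x∈A))

  leftEnds-normal⁺ : ∀ {A : Subset} {Ks K x} → Normal Ks → A ≐ ⋃⁺ Ks → K ∈ˡ Ks → x ≈ lo K →
                     LeftEnds A x
  leftEnds-normal⁺ {K = K} nKs A≐ K∈ x≈l =
    toClosed K , normal-isMaximal nKs A≐ K∈ ,
    least-resp (≐-sym (toClosed-≐ K))
      ((inj₂ (<.Eq.sym x≈l) , ≤⁺-trans (hi K) (inj₂ x≈l) (nonEmpty K)) ,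
       λ y y∈ → ≤.trans (inj₂ x≈l) (proj₁ y∈))

  leftEnds-normal⁻ : ∀ {A : Subset} {Ks x} → Normal Ks → A ≐ ⋃⁺ Ks → LeftEnds A x →
                     ∃[ K ] K ∈ˡ Ks × x ≈ lo K
  leftEnds-normal⁻ nKs A≐ (J , J-max , J-least) with isMaximal⇒normal nKs A≐ J-max (proj₁ J-least)
  ... | K , K∈ , J≐K with least-resp J≐K J-least
  ...   | x∈ , x≤ = K , K∈ , ≤.antisym (x≤ (lo K) (lo∈ K)) (proj₁ x∈)

  rightEnds-normal⁺ : ∀ {A : Subset} {Ks K b x} → Normal Ks → A ≐ ⋃⁺ Ks → K ∈ˡ Ks →
                      hi K ≡ just b → x ≈ b → RightEnds A x
  rightEnds-normal⁺ {K = K@(interval _ _ l≤b)} nKs A≐ K∈ refl x≈b =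
    toClosed K , normal-isMaximal nKs A≐ K∈ ,
    greatest-resp (≐-sym (toClosed-≐ K))
      ((≤.trans l≤b (inj₂ (<.Eq.sym x≈b)) , inj₂ x≈b) ,
       λ y y∈ → ≤.trans (proj₂ y∈) (inj₂ (<.Eq.sym x≈b)))

  rightEnds-normal⁻ : ∀ {A : Subset} {Ks x} → Normal Ks → A ≐ ⋃⁺ Ks → RightEnds A x →
                      ∃[ K ] K ∈ˡ Ks × ∃[ b ] hi K ≡ just b × x ≈ b
  rightEnds-normal⁻ {x = x} nKs A≐ (J , J-max , J-greatest)
    with isMaximal⇒normal nKs A≐ J-max (proj₁ J-greatest)
  ... | K , K∈ , J≐K with K | greatest-resp J≐K J-greatest
  ...   | interval l (just b) l≤b | x∈ , ≤x =
    _ , K∈ , b , refl , ≤.antisym (proj₂ x∈) (≤x b (l≤b , ≤.refl))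
  ...   | interval l nothing _ | x∈ , ≤x =
    let y , x<y = no-right-endpoint x
    in ⊥-elim (<⇒≱ x<y (≤x y (≤.trans (proj₁ x∈) (inj₁ x<y) , _)))

  leftEnds-⊆ : ∀ {A x} → LeftEnds A x → x ∈ A
  leftEnds-⊆ (_ , (J⊆A , _) , (x∈J , _)) = J⊆A x∈J

  rightEnds-⊆ : ∀ {A x} → RightEnds A x → x ∈ A
  rightEnds-⊆ (_ , (J⊆A , _) , (x∈J , _)) = J⊆A x∈J

  -- This test replaces maximal intervals in the study of `l`. If the normal interval of `y` began
  -- before `y`, it would fill the whole stretch up to `y` and leave no room for a gap. At the point
  -- 0 the gap condition is vacuous.
  leftEnd⁺ : ∀ {A y} → IsFci A → y ∈ A →
             (∀ u → u < y → ∃[ v ] u ≤ v × v < y × ¬ (v ∈ A)) → LeftEnds A y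
  leftEnd⁺ {y = y} fA y∈A gap with normalForm fA
  ... | Ks , nKs , A≐@(A⊆ , ⊆A) with find (A⊆ y∈A)
  ...   | K , K∈ , y∈K with ≤-split (proj₁ y∈K)
  ...     | inj₁ y≈l = leftEnds-normal⁺ nKs A≐ K∈ y≈l
  ...     | inj₂ l<y with gap (lo K) l<y
  ...       | v , l≤v , v<y , v∉A =
    ⊥-elim (v∉A (⊆A (lose K∈ (convex K (lo∈ K) y∈K l≤v (inj₁ v<y)))))

  -- Otherwise the stretch from `u` to `y`, joined to the normal interval that begins at `y`, would
  -- be a larger interval inside `A`, against maximality.
  leftEnd⁻ : ∀ {A u y} → IsFci A → LeftEnds A y → u < y → ¬ (∀ v → u ≤ v → v ≤ y → v ∈ A)
  leftEnd⁻ {u = u} {y} fA y∈lA u<y [u,y]⊆A with normalForm fA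
  ... | Ks , nKs , A≐ with leftEnds-normal⁻ nKs A≐ y∈lA
  ...   | K , K∈ , y≈l
    with join (interval u (just y) (inj₁ u<y)) K (inj₁ u<y , ≤.refl)
           (inj₂ (<.Eq.sym y≈l) , ≤⁺-trans (hi K) (inj₂ y≈l) (nonEmpty K))
  ...     | L , L⊆ , ⊆L =
    <⇒≱ u<y (≤.trans (inj₂ y≈l) (proj₁
      (normal-maximal nKs A≐ K∈ L (⊆L ∘ inj₂)
        (λ p → [ (λ (u≤v , v≤y) → [u,y]⊆A _ u≤v v≤y) , (λ q → proj₂ A≐ (lose K∈ q)) ]′ (L⊆ p))
        (⊆L (inj₁ (≤.refl , inj₁ u<y))))))

  rightEnd⁺ : ∀ {A y} → IsFci A → y ∈ A →
              (∀ u → y < u → ∃[ v ] y < v × v ≤ u × ¬ (v ∈ A)) → RightEnds A y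
  rightEnd⁺ {y = y} fA y∈A gap with normalForm fA
  ... | Ks , nKs , A≐@(A⊆ , ⊆A) with find (A⊆ y∈A)
  ...   | interval l nothing _ , K∈ , l≤y , _ =
    let u , y<u = no-right-endpoint y
        v , y<v , _ , v∉A = gap u y<u
    in ⊥-elim (v∉A (⊆A (lose K∈ (≤.trans l≤y (inj₁ y<v) , _))))
  ...   | interval l (just b) _ , K∈ , l≤y , inj₂ y≈b = rightEnds-normal⁺ nKs A≐ K∈ refl y≈b
  ...   | interval l (just b) _ , K∈ , l≤y , inj₁ y<b =
    let v , y<v , v≤b , v∉A = gap b y<b
    in ⊥-elim (v∉A (⊆A (lose K∈ (≤.trans l≤y (inj₁ y<v) , v≤b))))

  rightEnd⁻ : ∀ {A u y} → IsFci A → RightEnds A y → y < u → ¬ (∀ v → y ≤ v → v ≤ u → v ∈ A)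
  rightEnd⁻ {u = u} {y} fA y∈rA y<u [y,u]⊆A with normalForm fA
  ... | Ks , nKs , A≐ with rightEnds-normal⁻ nKs A≐ y∈rA
  ...   | K@(interval l _ l≤b) , K∈ , b , refl , y≈b
    with join K (interval y (just u) (inj₁ y<u)) (≤.trans l≤b (inj₂ (<.Eq.sym y≈b)) , inj₂ y≈b)
           (≤.refl , inj₁ y<u)
  ...     | L , L⊆ , ⊆L =
    <⇒≱ y<u (≤.trans (proj₂
      (normal-maximal nKs A≐ K∈ L (⊆L ∘ inj₁)
        (λ p → [ (λ q → proj₂ A≐ (lose K∈ q)) , (λ (y≤v , v≤u) → [y,u]⊆A _ y≤v v≤u) ]′ (L⊆ p))
        (⊆L (inj₂ (inj₁ y<u , ≤.refl))))) (inj₂ (<.Eq.sym y≈b)))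

  -- Grids and the words of tuples on them.

  -- A `Subset` need not respect `≈`, so `end` asks for every `x ≈ p`; `label-end` supplies this for
  -- finite unions of intervals.
  Label : Subset → Carrier → Maybe Carrier → Kind → Set (c ⊔ ℓ₁ ⊔ ℓ₂)
  Label A p h out = ∀ x → p ≤ x → x <⁺ h → ¬ (x ∈ A)
  Label A p h end = (∀ x → x ≈ p → x ∈ A) × (∀ x → p < x → x <⁺ h → ¬ (x ∈ A))
  Label A p h on  = ∀ x → p ≤ x → x ≤⁺ h → x ∈ A

  data Grid : Carrier → ℕ → Set (c ⊔ ℓ₂) where
    ray : ∀ {p} → Grid p 1
    _◂_ : ∀ {p p′ m} → p < p′ → Grid p′ m → Grid p (suc m)

  Labels : ∀ {p m} → Subset → Grid p m → Vec Kind m → Set (c ⊔ ℓ₁ ⊔ ℓ₂)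
  Labels {p} A ray               (k ∷ []) = Label A p nothing k
  Labels {p} A (_◂_ {p′ = p′} _ G) (k ∷ ks) = Label A p (just p′) k × Labels A G ks

  Cells : ∀ {p n m} → Vec 𝒫fci n → Grid p m → Word n m → Set (c ⊔ ℓ₁ ⊔ ℓ₂)
  Cells ρ G w = ∀ i → Labels (proj₁ (lookup ρ i)) G (column i w)

  -- The left end separates `out` from the other kinds, and an interior point separates `end` from
  -- `on`. Hence equality of sets becomes equality of words on a common grid.
  label-unique : ∀ {A p h k l} → p <⁺ h → Label A p h k → Label A p h l → k ≡ l
  label-unique {p = p} {h} {k} {l} p<h = go k l
    where
    x = proj₁ (between h p<h)
    p<x = proj₁ (proj₂ (between h p<h))
    x<h = proj₂ (proj₂ (between h p<h))
    go : ∀ k l → Label _ p h k → Label _ p h l → k ≡ l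
    go out out _ _ = refl
    go end end _ _ = refl
    go on  on  _ _ = refl
    go out end f g = ⊥-elim (f p ≤.refl p<h (proj₁ g p <.Eq.refl))
    go out on  f g = ⊥-elim (f p ≤.refl p<h (g p ≤.refl (<⁺⇒≤⁺ h p<h)))
    go end out f g = ⊥-elim (g p ≤.refl p<h (proj₁ f p <.Eq.refl))
    go end on  f g = ⊥-elim (proj₂ f x p<x x<h (g x (inj₁ p<x) (<⁺⇒≤⁺ h x<h)))
    go on  out f g = ⊥-elim (g p ≤.refl p<h (f p ≤.refl (<⁺⇒≤⁺ h p<h)))
    go on  end f g = ⊥-elim (proj₂ g x p<x x<h (f x (inj₁ p<x) (<⁺⇒≤⁺ h x<h)))

  labels-unique : ∀ {A p m} (G : Grid p m) {ks ls} → Labels A G ks → Labels A G ls → ks ≡ ls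
  labels-unique ray {_ ∷ []} {_ ∷ []} f g = cong (_∷ []) (label-unique {h = nothing} _ f g)
  labels-unique {A} (p<p′ ◂ G) {_ ∷ _} {_ ∷ _} (f , fs) (g , gs) =
    cong₂ _∷_ (label-unique {A} p<p′ f g) (labels-unique G fs gs)

  label-⊆ : ∀ {A B p h} k → Label A p h k → Label B p h k →
            ∀ {x} → p ≤ x → x <⁺ h → x ∈ A → x ∈ B
  label-⊆ out f g p≤x x<h x∈A = ⊥-elim (f _ p≤x x<h x∈A)
  label-⊆ end f g p≤x x<h x∈A with ≤-split p≤x
  ... | inj₁ x≈p = proj₁ g _ x≈p
  ... | inj₂ p<x = ⊥-elim (proj₂ f _ p<x x<h x∈A)
  label-⊆ {h = h} on f g p≤x x<h x∈A = g _ p≤x (<⁺⇒≤⁺ h x<h)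

  labels-⊆ : ∀ {A B p m} (G : Grid p m) ks → Labels A G ks → Labels B G ks →
             ∀ {x} → p ≤ x → x ∈ A → x ∈ B
  labels-⊆ {A} {B} ray (k ∷ []) f g p≤x = label-⊆ {A} {B} k f g p≤x _
  labels-⊆ {A} {B} (_◂_ {p′ = p′} _ G) (k ∷ ks) (f , fs) (g , gs) {x} p≤x with ≤-or-> p′ x
  ... | inj₁ p′≤x = labels-⊆ G ks fs gs p′≤x
  ... | inj₂ x<p′ = label-⊆ {A} {B} k f g p≤x x<p′

  label-cong : ∀ {A B : Subset} {p h} k → (∀ x → p ≤ x → x ∈ A ⇔ x ∈ B) →
               Label A p h k → Label B p h k
  label-cong out eq f = λ x p≤x x<h x∈B → f x p≤x x<h (from (eq x p≤x) x∈B)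
  label-cong end eq (f , g) =
    (λ x x≈p → to (eq x (inj₂ (<.Eq.sym x≈p))) (f x x≈p)) ,
    (λ x p<x x<h x∈B → g x p<x x<h (from (eq x (inj₁ p<x)) x∈B))
  label-cong on  eq f = λ x p≤x x≤h → to (eq x p≤x) (f x p≤x x≤h)

  labels-cong : ∀ {A B : Subset} {p m} (G : Grid p m) ks → (∀ x → p ≤ x → x ∈ A ⇔ x ∈ B) →
                Labels A G ks → Labels B G ks
  labels-cong ray        (k ∷ []) eq f        = label-cong k eq f
  labels-cong (p<p′ ◂ G) (k ∷ ks) eq (f , fs) =
    label-cong k eq f , labels-cong G ks (λ x p′≤x → eq x (≤.trans (inj₁ p<p′) p′≤x)) fs

  labels-≐ : ∀ {A B : Subset} {p m} (G : Grid p m) ks → A ≐ B → Labels A G ks → Labels B G ks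
  labels-≐ G ks (A⊆B , B⊆A) = labels-cong G ks (λ _ _ → mk⇔ A⊆B B⊆A)

  label-end : ∀ {A p h} → IsFci A → p ∈ A → (∀ x → p < x → x <⁺ h → ¬ (x ∈ A)) → Label A p h end
  label-end fA p∈A f = (λ x x≈p → fci-resp fA (<.Eq.sym x≈p) p∈A) , f

  label-meets : ∀ {A p h} k → k ≢ out → p <⁺ h → Label A p h k → p ∈ A
  label-meets         out k≢ _   _ = ⊥-elim (k≢ refl)
  label-meets         end _  _   f = proj₁ f _ <.Eq.refl
  label-meets {h = h} on  _  p<h f = f _ ≤.refl (<⁺⇒≤⁺ h p<h)

  -- The operations of the structure computed on words.

  Operation : Set _
  Operation = 𝒫fci → 𝒫fci → 𝒫fci

  Tracks : Operation → Transducer → Set _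
  Tracks f F = ∀ {m} (G : Grid 0# m) A B {ks ls} → Labels (proj₁ A) G ks → Labels (proj₁ B) G ls →
               Labels (proj₁ (f A B)) G (F ks ls)

  -- `Inv A B s p` is the meaning of the bit `s` at the cut point `p`. It has to be re-established
  -- only if the cell is bounded, since nothing follows the ray.
  module SequentialOperation
    {initial : Bool} {output : Bool → Kind → Kind → Kind} {following : Bool → Kind → Kind → Bool}
    (f : Operation)
    (Inv : 𝒫fci → 𝒫fci → Bool → Carrier → Set (c ⊔ ℓ₁ ⊔ ℓ₂))
    (inv-start : ∀ A B → Inv A B initial 0#)
    (step : ∀ A B s {p} h k l → p <⁺ h → Inv A B s p →
            Label (proj₁ A) p h k → Label (proj₁ B) p h l →
            Label (proj₁ (f A B)) p h (output s k l) ×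
            (∀ {p′} → h ≡ just p′ → Inv A B (following s k l) p′))
    where

    open Sequential initial output following

    tracks : Tracks f (run initial)
    tracks G A B {ks} {ls} = go G ks ls initial (inv-start A B)
      where
      go : ∀ {p m} (G : Grid p m) ks ls s → Inv A B s p →
           Labels (proj₁ A) G ks → Labels (proj₁ B) G ls → Labels (proj₁ (f A B)) G (run s ks ls)
      go ray (k ∷ []) (l ∷ []) s inv a b = proj₁ (step A B s nothing k l _ inv a b)
      go (p<p′ ◂ G) (k ∷ ks) (l ∷ ls) s inv (a , as) (b , bs)
        with step A B s (just _) k l p<p′ inv a b
      ... | r , inv′ = r , go G ks ls _ (inv′ refl) as bs

  record Trackable (f : Operation) : Set (lsuc (c ⊔ ℓ₁ ⊔ ℓ₂)) where
    constructor trackable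
    field
      {transducer} : Transducer
      graph        : Graph transducer
      tracks       : Tracks f transducer

  pointwise : (g : Kind → Kind → Kind) (f : Operation) →
    (∀ A B {p} h k l → p <⁺ h → Label (proj₁ A) p h k → Label (proj₁ B) p h l →
     Label (proj₁ (f A B)) p h (g k l)) → Trackable f
  pointwise g f step = trackable sequential-graph (SequentialOperation.tracks f
    (λ _ _ _ _ → Polymorphic.⊤) (λ _ _ → _)
    (λ A B _ h k l p<h _ a b → step A B h k l p<h a b , λ _ → _))
    where open Sequential false (λ _ → g) (λ _ _ _ → false)

  first-op ∪-op ∩-op ∅-op zero-op min-op max-op left-op right-op : Operation
  first-op A       B       = A
  ∪-op    (A , fA) (B , fB) = A ∪ B , ∪-isFci fA fB
  ∩-op    (A , fA) (B , fB) = A ∩ B , ∩-isFci fA fB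
  ∅-op     _        _       = ⟦ ⊥′ ⟧ᵗ []
  zero-op  _        _       = ⟦ c₀ ⟧ᵗ []
  min-op  (A , fA)  _       = Min A , Min-isFci fA
  max-op  (A , fA)  _       = Max A , Max-isFci fA
  left-op (A , fA)  _       = LeftEnds A , LeftEnds-isFci fA
  right-op (A , fA) _       = RightEnds A , RightEnds-isFci fA

  first-trackable : Trackable first-op
  first-trackable = pointwise (λ k _ → k) first-op (λ A B h k l p<h a b → a)

  _∪ᵏ_ _∩ᵏ_ : Kind → Kind → Kind
  out ∪ᵏ l   = l
  on  ∪ᵏ l   = on
  end ∪ᵏ on  = on
  end ∪ᵏ _   = end
  out ∩ᵏ l   = out
  on  ∩ᵏ l   = l
  end ∩ᵏ out = out
  end ∩ᵏ _   = end

  ∪-trackable : Trackable ∪-op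
  ∪-trackable = pointwise _∪ᵏ_ ∪-op step
    where
    step : ∀ A B {p} h k l → p <⁺ h → Label (proj₁ A) p h k → Label (proj₁ B) p h l →
           Label (proj₁ A ∪ proj₁ B) p h (k ∪ᵏ l)
    step A B h out out _ a b = λ x p≤x x<h → [ a x p≤x x<h , b x p≤x x<h ]′
    step A B h out end _ a (b , b′) =
      (λ x → inj₂ ∘ b x) , λ x p<x x<h → [ a x (inj₁ p<x) x<h , b′ x p<x x<h ]′
    step A B h out on  _ a b = λ x p≤x x≤h → inj₂ (b x p≤x x≤h)
    step A B h end out _ (a , a′) b =
      (λ x → inj₁ ∘ a x) , λ x p<x x<h → [ a′ x p<x x<h , b x (inj₁ p<x) x<h ]′
    step A B h end end _ (a , a′) (b , b′) =
      (λ x → inj₁ ∘ a x) , λ x p<x x<h → [ a′ x p<x x<h , b′ x p<x x<h ]′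
    step A B h end on  _ a b = λ x p≤x x≤h → inj₂ (b x p≤x x≤h)
    step A B h on  l   _ a b = λ x p≤x x≤h → inj₁ (a x p≤x x≤h)

  ∩-trackable : Trackable ∩-op
  ∩-trackable = pointwise _∩ᵏ_ ∩-op step
    where
    step : ∀ A B {p} h k l → p <⁺ h → Label (proj₁ A) p h k → Label (proj₁ B) p h l →
           Label (proj₁ A ∩ proj₁ B) p h (k ∩ᵏ l)
    step A B h out l   _ a b = λ x p≤x x<h → a x p≤x x<h ∘ proj₁
    step A B h end out _ a b = λ x p≤x x<h → b x p≤x x<h ∘ proj₂
    step A B h end end _ (a , a′) (b , _) =
      (λ x x≈p → a x x≈p , b x x≈p) , λ x p<x x<h → a′ x p<x x<h ∘ proj₁
    step A B {p} h end on p<h (a , a′) b =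
      (λ x x≈p → a x x≈p , b x (inj₂ (<.Eq.sym x≈p)) (≤⁺-trans h (inj₂ x≈p) (<⁺⇒≤⁺ h p<h))) ,
      λ x p<x x<h → a′ x p<x x<h ∘ proj₁
    step A B h on out  _ a b = λ x p≤x x<h → b x p≤x x<h ∘ proj₂
    step A B h on end p<h a (b , b′) =
      (λ x x≈p → a x (inj₂ (<.Eq.sym x≈p)) (≤⁺-trans h (inj₂ x≈p) (<⁺⇒≤⁺ h p<h)) , b x x≈p) ,
      λ x p<x x<h → b′ x p<x x<h ∘ proj₂
    step A B h on on   _ a b = λ x p≤x x≤h → a x p≤x x≤h , b x p≤x x≤h

  ∅-trackable : Trackable ∅-op
  ∅-trackable = pointwise (λ _ _ → out) ∅-op (λ _ _ _ _ _ _ _ _ _ _ _ ())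

  zero-trackable : Trackable zero-op
  zero-trackable = trackable sequential-graph (SequentialOperation.tracks zero-op Inv
    (λ _ _ → lift <.Eq.refl) step)
    where
    output : Bool → Kind → Kind → Kind
    output s _ _ = if s then end else out
    following : Bool → Kind → Kind → Bool
    following _ _ _ = false
    open Sequential true output following
    Inv : 𝒫fci → 𝒫fci → Bool → Carrier → Set (c ⊔ ℓ₁ ⊔ ℓ₂)
    Inv _ _ true  p = Lift (c ⊔ ℓ₁ ⊔ ℓ₂) (p ≈ 0#)
    Inv _ _ false p = Lift (c ⊔ ℓ₁ ⊔ ℓ₂) (0# < p)
    step : ∀ A B s {p} h k l → p <⁺ h → Inv A B s p →
           Label (proj₁ A) p h k → Label (proj₁ B) p h l →
           Label (proj₁ (zero-op A B)) p h (output s k l) ×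
           (∀ {p′} → h ≡ just p′ → Inv A B false p′)
    step A B true h k l p<h (lift p≈0) _ _ =
      ((λ x x≈p → lift (<.Eq.trans x≈p p≈0)) ,
       (λ x p<x _ (lift x≈0) → <.irrefl (<.Eq.trans p≈0 (<.Eq.sym x≈0)) p<x)) ,
      λ { refl → lift (<.<-respˡ-≈ p≈0 p<h) }
    step A B false h k l p<h (lift 0<p) _ _ =
      (λ x p≤x _ (lift x≈0) → <.irrefl (<.Eq.sym x≈0) (<-≤-trans 0<p p≤x)) ,
      λ { refl → lift (<.trans 0<p p<h) }

  min-trackable : Trackable min-op
  min-trackable = trackable sequential-graph (SequentialOperation.tracks min-op Inv
    (λ _ _ u _ → 0#-minimum u) step)
    where
    output : Bool → Kind → Kind → Kind
    output true  _   _ = out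
    output false out _ = out
    output false _   _ = end
    following : Bool → Kind → Kind → Bool
    following false out _ = false
    following _     _   _ = true
    open Sequential false output following
    Inv : 𝒫fci → 𝒫fci → Bool → Carrier → Set (c ⊔ ℓ₁ ⊔ ℓ₂)
    Inv A _ true  p = ∃[ u ] u ∈ proj₁ A × u < p
    Inv A _ false p = ∀ u → u ∈ proj₁ A → p ≤ u
    meets : ∀ A {p} h k → k ≢ out → p <⁺ h → (∀ u → u ∈ proj₁ A → p ≤ u) → Label (proj₁ A) p h k →
            Label (Min (proj₁ A)) p h end × (∀ {p′} → h ≡ just p′ → ∃[ u ] u ∈ proj₁ A × u < p′)
    meets A@(_ , fA) {p} h k k≢ p<h inv a =
      label-end {h = h} (Min-isFci fA) (p∈A , inv)
        (λ x p<x _ x-least → <⇒≱ p<x (proj₂ x-least p p∈A)) ,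
      λ { refl → p , p∈A , p<h }
      where
      p∈A = label-meets k k≢ p<h a
    step : ∀ A B s {p} h k l → p <⁺ h → Inv A B s p →
           Label (proj₁ A) p h k → Label (proj₁ B) p h l →
           Label (Min (proj₁ A)) p h (output s k l) ×
           (∀ {p′} → h ≡ just p′ → Inv A B (following s k l) p′)
    step A B true h k l p<h (u , u∈A , u<p) a b =
      (λ x p≤x _ x-least → <⇒≱ (<-≤-trans u<p p≤x) (proj₂ x-least u u∈A)) ,
      λ { refl → u , u∈A , <.trans u<p p<h }
    step A B false h out l p<h inv a b =
      (λ x p≤x x<h → a x p≤x x<h ∘ proj₁) ,
      λ { refl u u∈A → [ id , (λ u<p′ → ⊥-elim (a u (inv u u∈A) u<p′ u∈A)) ]′ (≤-or-> _ u) }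
    step A B false h end l p<h inv a b = meets A h end (λ ()) p<h inv a
    step A B false h on  l p<h inv a b = meets A h on (λ ()) p<h inv a

  -- A left endpoint can occur only at the left end of a cell, and an occupied left end is one
  -- exactly when no part of `A` arrives from the left, that is, when the previous kind is not `on`.
  -- The bit records this.
  left-trackable : Trackable left-op
  left-trackable = trackable sequential-graph (SequentialOperation.tracks left-op Inv
    (λ _ _ u u<0 → ⊥-elim (<⇒≱ u<0 (0#-minimum u))) step)
    where
    output : Bool → Kind → Kind → Kind
    output true  _   _ = out
    output false out _ = out
    output false _   _ = end
    following : Bool → Kind → Kind → Bool
    following _ k _ = isOn k
    open Sequential false output following
    Inv : 𝒫fci → 𝒫fci → Bool → Carrier → Set (c ⊔ ℓ₁ ⊔ ℓ₂)
    Inv (A , _) _ true  p = ∃[ u ] u < p × (∀ v → u ≤ v → v ≤ p → v ∈ A)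
    Inv (A , _) _ false p = ∀ u → u < p → ∃[ v ] u ≤ v × v < p × ¬ (v ∈ A)
    inside : ∀ {A} → IsFci A → ∀ {p} h k → p <⁺ h → Label A p h k →
             ∀ x → p < x → x <⁺ h → ¬ LeftEnds A x
    inside fA h out _ a x p<x x<h x∈l = a x (inj₁ p<x) x<h (leftEnds-⊆ x∈l)
    inside fA h end _ a x p<x x<h x∈l = proj₂ a x p<x x<h (leftEnds-⊆ x∈l)
    inside fA h on  _ a x p<x x<h x∈l =
      leftEnd⁻ fA x∈l p<x λ v p≤v v≤x → a v p≤v (≤⁺-trans h v≤x (<⁺⇒≤⁺ h x<h))
    leave : ∀ A B {p p′} k → p < p′ → Label (proj₁ A) p (just p′) k → Inv A B (isOn k) p′
    leave A B {p} out p<p′ a u u<p′ with upper u p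
    ... | m , u≤m , p≤m , inj₁ refl = m , u≤m , u<p′ , a m p≤m u<p′
    ... | m , u≤m , p≤m , inj₂ refl = m , u≤m , p<p′ , a m p≤m p<p′
    -- Here `p` itself lies in `A`, so the point outside `A` is taken strictly above both `u` and
    -- `p`.
    leave A B {p} end p<p′ (_ , a) u u<p′ with upper u p
    ... | m , u≤m , p≤m , m≡ with dense (m<p′ m≡)
      where
      m<p′ : ∀ {m} → m ≡ u ⊎ m ≡ p → m < _
      m<p′ (inj₁ refl) = u<p′
      m<p′ (inj₂ refl) = p<p′
    ...   | v , m<v , v<p′ =
      v , ≤.trans u≤m (inj₁ m<v) , v<p′ , a v (≤-<-trans p≤m m<v) v<p′
    leave A B {p} on p<p′ a = p , p<p′ , a
    starts : ∀ {A} → IsFci A → ∀ {p} h k → k ≢ out → p <⁺ h → Label A p h k →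
             (∀ u → u < p → ∃[ v ] u ≤ v × v < p × ¬ (v ∈ A)) → Label (LeftEnds A) p h end
    starts fA h k k≢ p<h a inv =
      label-end {h = h} (LeftEnds-isFci fA) (leftEnd⁺ fA (label-meets k k≢ p<h a) inv)
        (inside fA h k p<h a)
    label : ∀ A B s {p} h k l → p <⁺ h → Inv A B s p → Label (proj₁ A) p h k →
            Label (LeftEnds (proj₁ A)) p h (output s k l)
    label (_ , fA) B true h k l p<h (u , u<p , ⊆A) a x p≤x x<h x∈l with ≤-split p≤x
    ... | inj₁ x≈p = leftEnd⁻ fA x∈l (<-≤-trans u<p p≤x)
                       λ v u≤v v≤x → ⊆A v u≤v (≤.trans v≤x (inj₂ x≈p))
    ... | inj₂ p<x = inside fA h k p<h a x p<x x<h x∈l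
    label A        B false h out l p<h inv a x p≤x x<h x∈l = a x p≤x x<h (leftEnds-⊆ x∈l)
    label (_ , fA) B false h end l p<h inv a = starts fA h end (λ ()) p<h a inv
    label (_ , fA) B false h on  l p<h inv a = starts fA h on (λ ()) p<h a inv
    step : ∀ A B s {p} h k l → p <⁺ h → Inv A B s p →
           Label (proj₁ A) p h k → Label (proj₁ B) p h l →
           Label (LeftEnds (proj₁ A)) p h (output s k l) ×
           (∀ {p′} → h ≡ just p′ → Inv A B (following s k l) p′)
    step A B s h k l p<h inv a b = label A B s h k l p<h inv a , λ { refl → leave A B k p<h a }

  right-trackable : Trackable right-op
  right-trackable = pointwise output right-op step
    where
    output : Kind → Kind → Kind
    output out _ = out
    output end _ = end
    output on  _ = out
    step : ∀ A B {p} h k l → p <⁺ h → Label (proj₁ A) p h k → Label (proj₁ B) p h l →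
           Label (RightEnds (proj₁ A)) p h (output k l)
    step A B h out l p<h a _ x p≤x x<h x∈r = a x p≤x x<h (rightEnds-⊆ x∈r)
    step (A , fA) B {p} h end l p<h (a , a′) _ =
      label-end {h = h} (RightEnds-isFci fA) (rightEnd⁺ fA (a p <.Eq.refl) (gap h p<h a′))
        (λ x p<x x<h x∈r → a′ x p<x x<h (rightEnds-⊆ x∈r))
      where
      gap : ∀ h → p <⁺ h → (∀ x → p < x → x <⁺ h → ¬ (x ∈ A)) →
            ∀ u → p < u → ∃[ v ] p < v × v ≤ u × ¬ (v ∈ A)
      gap nothing  _   a′ u p<u = u , p<u , ≤.refl , a′ u p<u _
      gap (just b) p<b a′ u p<u with ≤-or-> b u
      ... | inj₂ u<b = u , p<u , ≤.refl , a′ u p<u u<b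
      ... | inj₁ b≤u = let v , p<v , v<b = dense p<b
                       in v , p<v , ≤.trans (inj₁ v<b) b≤u , a′ v p<v v<b
    step (A , fA) B h on l p<h a _ x p≤x x<h x∈r =
      let u , x<u , u<h = between h x<h
      in rightEnd⁻ fA x∈r x<u λ v x≤v v≤u →
           a v (≤.trans p≤x x≤v) (≤⁺-trans h v≤u (<⁺⇒≤⁺ h u<h))

  allOut-true : ∀ {A p m} (G : Grid p m) ks → Labels A G ks → allOut ks ≡ true →
                ∀ x → p ≤ x → ¬ (x ∈ A)
  allOut-true ray (out ∷ []) a _ x p≤x = a x p≤x _
  allOut-true (_◂_ {p′ = p′} _ G) (out ∷ ks) (a , as) eq x p≤x with ≤-or-> p′ x
  ... | inj₁ p′≤x = allOut-true G ks as eq x p′≤x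
  ... | inj₂ x<p′ = a x p≤x x<p′

  allOut-false : ∀ {A p m} (G : Grid p m) ks → Labels A G ks → allOut ks ≡ false →
                 ∃[ x ] p ≤ x × x ∈ A
  allOut-false {p = p} ray (end ∷ []) (a , _) _ = p , ≤.refl , a p <.Eq.refl
  allOut-false {p = p} ray (on  ∷ []) a       _ = p , ≤.refl , a p ≤.refl _
  allOut-false (p<p′ ◂ G) (out ∷ ks) (_ , as) eq =
    let x , p′≤x , x∈A = allOut-false G ks as eq in x , ≤.trans (inj₁ p<p′) p′≤x , x∈A
  allOut-false {p = p} (_    ◂ G) (end ∷ ks) ((a , _) , _) _ = p , ≤.refl , a p <.Eq.refl
  allOut-false {p = p} (p<p′ ◂ G) (on  ∷ ks) (a       , _) _ = p , ≤.refl , a p ≤.refl (inj₁ p<p′)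

  max-trackable : Trackable max-op
  max-trackable = trackable max-graph λ G A B as _ → go (proj₁ A) (proj₂ A) G _ _ as
    where
    notMax-on : ∀ {A p} h → p <⁺ h → Label A p h on → Label (Max A) p h out
    notMax-on h p<h a x p≤x x<h x-greatest =
      let y , x<y , y<h = between h x<h
      in <⇒≱ x<y (proj₂ x-greatest y (a y (≤.trans p≤x (inj₁ x<y)) (<⁺⇒≤⁺ h y<h)))
    isMax : ∀ {A p} h → IsFci A → Label A p h end → (∀ y → y ∈ A → y ≤ p) → Label (Max A) p h end
    isMax {p = p} h fA (a , a′) ≤p =
      label-end {h = h} (Max-isFci fA) (a p <.Eq.refl , ≤p) λ x p<x x<h → a′ x p<x x<h ∘ proj₁
    go : ∀ A → IsFci A → ∀ {p m} (G : Grid p m) ks ls → Labels A G ks →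
         Labels (Max A) G (maxRun ks ls)
    go A fA ray (out ∷ []) (_ ∷ []) a = λ x p≤x x<h → a x p≤x x<h ∘ proj₁
    go A fA {p} ray (end ∷ []) (_ ∷ []) a =
      isMax nothing fA a λ y y∈A → [ id , (λ p<y → ⊥-elim (proj₂ a y p<y _ y∈A)) ]′ (≤-or-> y p)
    go A fA ray (on  ∷ []) (_ ∷ []) a = notMax-on nothing _ a
    go A fA (p<p′ ◂ G) (out ∷ ks) (_ ∷ ls) (a , as) =
      (λ x p≤x x<h → a x p≤x x<h ∘ proj₁) , go A fA G ks ls as
    go A fA (p<p′ ◂ G) (on  ∷ ks) (_ ∷ ls) (a , as) = notMax-on (just _) p<p′ a , go A fA G ks ls as
    go A fA {p} (_◂_ {p′ = p′} p<p′ G) (end ∷ ks) (_ ∷ ls) (a , as) = this , go A fA G ks ls as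
      where
      this : Label (Max A) p (just p′) (lastEnd end (allOut ks))
      this with allOut ks in eq
      ... | false = λ x p≤x x<p′ x-greatest →
        let y , p′≤y , y∈A = allOut-false G ks as eq
        in <⇒≱ (<-≤-trans x<p′ p′≤y) (proj₂ x-greatest y y∈A)
      ... | true = isMax (just p′) fA a ≤p
        where
        ≤p : ∀ y → y ∈ A → y ≤ p
        ≤p y y∈A with ≤-or-> y p
        ... | inj₁ y≤p = y≤p
        ... | inj₂ p<y with ≤-or-> p′ y
        ...   | inj₁ p′≤y = ⊥-elim (allOut-true G ks as eq y p′≤y y∈A)
        ...   | inj₂ y<p′ = ⊥-elim (proj₂ a y p<y y<p′ y∈A)

  -- Refining a grid to fit one more set.

  Outside : Carrier → Carrier → Maybe Carrier → Set ℓ₂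
  Outside y p h = p < y → ¬ y <⁺ h

  Avoids : ∀ {p m} → Carrier → Grid p m → Set ℓ₂
  Avoids {p} y ray                 = Outside y p nothing
  Avoids {p} y (_◂_ {p′ = p′} _ G) = Outside y p (just p′) × Avoids y G

  CellAt : ∀ {n} → Vec 𝒫fci n → Carrier → Maybe Carrier → Letter n → Set _
  CellAt ρ p h a = ∀ i → Label (proj₁ (lookup ρ i)) p h (lookup a i)

  label-shrink : ∀ {A p x} h k → x <⁺ h → Label A p h k → Label A p (just x) k
  label-shrink h out x<h a = λ y p≤y y<x → a y p≤y (≤-<⁺-trans h (inj₁ y<x) x<h)
  label-shrink h end x<h (a , a′) = a , λ y p<y y<x → a′ y p<y (≤-<⁺-trans h (inj₁ y<x) x<h)
  label-shrink h on  x<h a = λ y p≤y y≤x → a y p≤y (≤⁺-trans h y≤x (<⁺⇒≤⁺ h x<h))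

  label-stay : ∀ {A p x h} k → p < x → Label A p h k → Label A x h (stay k)
  label-stay out p<x a        = λ y x≤y → a y (≤.trans (inj₁ p<x) x≤y)
  label-stay end p<x (_ , a)  = λ y x≤y → a y (<-≤-trans p<x x≤y)
  label-stay on  p<x a        = λ y x≤y → a y (≤.trans (inj₁ p<x) x≤y)

  cell-shrink : ∀ {n p x h} (ρ : Vec 𝒫fci n) a → x <⁺ h → CellAt ρ p h a → CellAt ρ p (just x) a
  cell-shrink {h = h} ρ a x<h cell i = label-shrink h (lookup a i) x<h (cell i)

  cell-stay : ∀ {n p x h} (ρ : Vec 𝒫fci n) a → p < x → CellAt ρ p h a → CellAt ρ x h (map stay a)
  cell-stay ρ a p<x cell i =
    subst (Label (proj₁ (lookup ρ i)) _ _) (sym (lookup-map i stay a))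
      (label-stay (lookup a i) p<x (cell i))

  avoids-below : ∀ {x p m} (G : Grid p m) → x < p → Avoids x G
  avoids-below ray        x<p = λ p<x → ⊥-elim (<.asym p<x x<p)
  avoids-below (p<p′ ◂ G) x<p =
    (λ p<x → ⊥-elim (<.asym p<x x<p)) , avoids-below G (<.trans x<p p<p′)

  -- The last component keeps points treated earlier out of the interiors of cells, so that cuts can
  -- be made one after another.
  insertPoint : ∀ {n p m} (ρ : Vec 𝒫fci n) x (G : Grid p m) w → Cells ρ G w →
    ∃[ m′ ] ∃₂ λ (G′ : Grid p m′) w′ → w ⊴ w′ × Cells ρ G′ w′ × Avoids x G′ ×
      (∀ y → Avoids y G → Avoids y G′)
  insertPoint {p = p} ρ x ray (a ∷ []) cells with ≤-or-> x p
  ... | inj₁ x≤p = 1 , ray , a ∷ [] , ⊴-refl , cells , (λ p<x _ → <⇒≱ p<x x≤p) , λ _ → id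
  ... | inj₂ p<x =
    2 , p<x ◂ ray , a ∷ map stay a ∷ [] , repeat ⊴-refl ,
    (λ i → cell-shrink ρ a _ cells i , cell-stay ρ a p<x cells i) ,
    ((λ _ → <.irrefl <.Eq.refl) , λ x<x → ⊥-elim (<.irrefl <.Eq.refl x<x)) ,
    λ y av → (λ p<y _ → av p<y _) , λ x<y → av (<.trans p<x x<y)
  insertPoint {p = p} ρ x (_◂_ {p′ = p′} p<p′ G) (a ∷ w) cells with ≤-or-> p′ x
  ... | inj₁ p′≤x with insertPoint ρ x G w (proj₂ ∘ cells)
  ...   | _ , G′ , w′ , r , cells′ , av , keep =
    _ , p<p′ ◂ G′ , a ∷ w′ , next r , (λ i → proj₁ (cells i) , cells′ i) ,
    ((λ _ x<p′ → <⇒≱ x<p′ p′≤x) , av) ,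
    λ { y (o , os) → o , keep y os }
  insertPoint {p = p} ρ x (_◂_ {p′ = p′} p<p′ G) (a ∷ w) cells | inj₂ x<p′ with ≤-or-> x p
  ... | inj₁ x≤p =
    _ , p<p′ ◂ G , a ∷ w , ⊴-refl , cells ,
    ((λ p<x _ → <⇒≱ p<x x≤p) , avoids-below G x<p′) , λ _ → id
  ... | inj₂ p<x =
    _ , p<x ◂ (x<p′ ◂ G) , a ∷ map stay a ∷ w , repeat ⊴-refl ,
    (λ i → cell-shrink ρ a x<p′ (proj₁ ∘ cells) i ,
           cell-stay ρ a p<x (proj₁ ∘ cells) i , proj₂ (cells i)) ,
    ((λ _ → <.irrefl <.Eq.refl) , (λ x<x → ⊥-elim (<.irrefl <.Eq.refl x<x)) , avoids-below G x<p′) ,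
    λ { y (o , os) → (λ p<y y<x → o p<y (<.trans y<x x<p′)) ,
                     (λ x<y → o (<.trans p<x x<y)) , os }

  IsEndpoint : NonEmptyInterval → Carrier → Set c
  IsEndpoint K y = y ≡ lo K ⊎ hi K ≡ just y

  Splits : ∀ {p m} → NonEmptyInterval → Grid p m → Set (c ⊔ ℓ₂)
  Splits K G = ∀ y → IsEndpoint K y → Avoids y G

  insertInterval : ∀ {n p m} (ρ : Vec 𝒫fci n) K (G : Grid p m) w → Cells ρ G w →
    ∃[ m′ ] ∃₂ λ (G′ : Grid p m′) w′ → w ⊴ w′ × Cells ρ G′ w′ × Splits K G′ ×
      (∀ y → Avoids y G → Avoids y G′)
  insertInterval ρ K@(interval l nothing _) G w cells with insertPoint ρ l G w cells
  ... | _ , G₁ , w₁ , r₁ , cells₁ , av , keep =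
    _ , G₁ , w₁ , r₁ , cells₁ , (λ { _ (inj₁ refl) → av }) , keep
  insertInterval ρ K@(interval l (just b) _) G w cells with insertPoint ρ l G w cells
  ... | _ , G₁ , w₁ , r₁ , cells₁ , av₁ , keep₁ with insertPoint ρ b G₁ w₁ cells₁
  ...   | _ , G₂ , w₂ , r₂ , cells₂ , av₂ , keep₂ =
    _ , G₂ , w₂ , ⊴-trans r₁ r₂ , cells₂ ,
    (λ { _ (inj₁ refl) → keep₂ _ av₁ ; _ (inj₂ refl) → av₂ }) , λ y → keep₂ y ∘ keep₁ y

  insertIntervals : ∀ {n p m} (ρ : Vec 𝒫fci n) Ks (G : Grid p m) w → Cells ρ G w →
    ∃[ m′ ] ∃₂ λ (G′ : Grid p m′) w′ → w ⊴ w′ × Cells ρ G′ w′ × (∀ {K} → K ∈ˡ Ks → Splits K G′)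
  insertIntervals ρ []       G w cells = _ , G , w , ⊴-refl , cells , λ ()
  insertIntervals ρ (K ∷ Ks) G w cells with insertIntervals ρ Ks G w cells
  ... | _ , G₁ , w₁ , r₁ , cells₁ , sp₁ with insertInterval ρ K G₁ w₁ cells₁
  ...   | _ , G₂ , w₂ , r₂ , cells₂ , sp₂ , keep =
    _ , G₂ , w₂ , ⊴-trans r₁ r₂ , cells₂ ,
    λ { (here refl) → sp₂ ; (there K∈) y y∈ → keep y (sp₁ K∈ y y∈) }

  -- With no endpoint strictly inside the cell, an interval meeting it begins by `p`, and one that
  -- also reaches beyond `p` covers the cell and its right end. Two tests at `p` therefore decide
  -- the kind.
  findLabel : ∀ Ks p h → p <⁺ h → (∀ {K} → K ∈ˡ Ks → ∀ y → IsEndpoint K y → Outside y p h) →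
              ∃[ k ] Label (⋃⁺ Ks) p h k
  findLabel Ks p h p<h outside = decide
    (Any.any? (λ K → (lo K ≤.≤? p) ×-dec (p <⁺? hi K)) Ks)
    (Any.any? (λ K → (lo K ≤.≤? p) ×-dec (p ≤⁺? hi K)) Ks)
    where
    _<⁺?_ : ∀ x h → Dec (x <⁺ h)
    x <⁺? just b  = x <.<? b
    x <⁺? nothing = yes _

    lo≤p : ∀ {K x} → K ∈ˡ Ks → x <⁺ h → x ∈ ⟪ K ⟫ → lo K ≤ p
    lo≤p {K} K∈ x<h (l≤x , _) with ≤-or-> (lo K) p
    ... | inj₁ l≤p = l≤p
    ... | inj₂ p<l = ⊥-elim (outside K∈ (lo K) (inj₁ refl) p<l (≤-<⁺-trans h l≤x x<h))

    covers : ∀ {K} → K ∈ˡ Ks → p <⁺ hi K → ∀ x → x ≤⁺ h → x ≤⁺ hi K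
    covers {interval _ nothing  _} _  _   _ _   = _
    covers {interval _ (just b) _} K∈ p<b x x≤h = go h (outside K∈ b (inj₂ refl) p<b) x≤h
      where
      go : ∀ h → ¬ (b <⁺ h) → x ≤⁺ h → x ≤ b
      go nothing  b≮h _ = ⊥-elim (b≮h _)
      go (just q) b≮q x≤q with ≤-or-> q b
      ... | inj₁ q≤b = ≤.trans x≤q q≤b
      ... | inj₂ b<q = ⊥-elim (b≮q b<q)

    <-≤⁺-trans : ∀ {x} g → p < x → x ≤⁺ g → p <⁺ g
    <-≤⁺-trans (just _) p<x x≤g = <-≤-trans p<x x≤g
    <-≤⁺-trans nothing  _   _   = _

    decide : Dec (Any (λ K → lo K ≤ p × p <⁺ hi K) Ks) → Dec (Any (λ K → p ∈ ⟪ K ⟫) Ks) →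
             ∃[ k ] Label (⋃⁺ Ks) p h k
    decide (yes above) _ with find above
    ... | K , K∈ , l≤p , p<hi = on , λ x p≤x x≤h → lose K∈ (≤.trans l≤p p≤x , covers K∈ p<hi x x≤h)
    decide (no ¬above) (yes p∈) = end , (λ x x≈p → ⋃⁺-resp (<.Eq.sym x≈p) p∈) , none
      where
      none : ∀ x → p < x → x <⁺ h → ¬ (x ∈ ⋃⁺ Ks)
      none x p<x x<h x∈ with find x∈
      ... | K , K∈ , x∈K = ¬above (lose K∈ (lo≤p K∈ x<h x∈K , <-≤⁺-trans (hi K) p<x (proj₂ x∈K)))
    decide (no ¬above) (no p∉) = out , none
      where
      none : ∀ x → p ≤ x → x <⁺ h → ¬ (x ∈ ⋃⁺ Ks)
      none x p≤x x<h x∈ with find x∈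
      ... | K , K∈ , x∈K = p∉ (lose K∈ (lo≤p K∈ x<h x∈K , ≤⁺-trans (hi K) p≤x (proj₂ x∈K)))

  findLabels : ∀ {p m} Ks (G : Grid p m) → (∀ {K} → K ∈ˡ Ks → Splits K G) →
               ∃[ ks ] Labels (⋃⁺ Ks) G ks
  findLabels Ks ray splits with findLabel Ks _ nothing _ splits
  ... | k , l = k ∷ [] , l
  findLabels Ks (p<p′ ◂ G) splits
    with findLabel Ks _ (just _) p<p′ (λ K∈ y y∈ → proj₁ (splits K∈ y y∈))
       | findLabels Ks G (λ K∈ y y∈ → proj₂ (splits K∈ y y∈))
  ... | k , l | ks , ls = k ∷ ks , l , ls

  cells-∷ : ∀ {n p m} (A : 𝒫fci) (ρ : Vec 𝒫fci n) (G : Grid p m) w →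
            Labels (proj₁ A) G (column zero w) → Cells ρ G (map tail w) → Cells (A ∷ ρ) G w
  cells-∷ A ρ G w a cells zero = a
  cells-∷ A ρ G w a cells (suc i) =
    subst (Labels (proj₁ (lookup ρ i)) G) (column-tail i w) (cells i)

  -- The endpoints of a normal form of `A` become cut points; the parameters see this only as a
  -- subdivision of their word.
  refine : ∀ {n p m} A (ρ : Vec 𝒫fci n) (G : Grid p m) w → Cells ρ G w →
    ∃[ m′ ] ∃₂ λ (G′ : Grid p m′) w′ → w ⊴ map tail w′ × Cells (A ∷ ρ) G′ w′
  refine A@(_ , fA) ρ G w cells with normalForm fA
  ... | Ks , _ , A≐ with insertIntervals ρ Ks G w cells
  ...   | m′ , G′ , w₁ , r , cells₁ , splits with findLabels Ks G′ splits
  ...     | ks , labels = m′ , G′ , Vec.zipWith _∷_ ks w₁ ,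
    subst (w ⊴_) (sym (tail-zip ks w₁)) r ,
    cells-∷ A ρ G′ (Vec.zipWith _∷_ ks w₁)
      (subst (Labels (proj₁ A) G′) (sym (head-zip ks w₁)) (labels-≐ G′ ks (≐-sym A≐) labels))
      (subst (Cells ρ G′) (sym (tail-zip ks w₁)) cells₁)
    where
    tail-zip : ∀ {n m} (ks : Vec Kind m) (w : Word n m) → map tail (Vec.zipWith _∷_ ks w) ≡ w
    tail-zip []       []      = refl
    tail-zip (k ∷ ks) (a ∷ w) = cong (a ∷_) (tail-zip ks w)
    head-zip : ∀ {n m} (ks : Vec Kind m) (w : Word n m) → column zero (Vec.zipWith _∷_ ks w) ≡ ks
    head-zip []       []      = refl
    head-zip (k ∷ ks) (a ∷ w) = cong (k ∷_) (head-zip ks w)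

  -- Realising a guessed track by a set.

  attach : Kind → ∀ p h → p ≤⁺ h → List NonEmptyInterval → List NonEmptyInterval
  attach out p h p≤h Js = Js
  attach end p h p≤h Js = singleton⁺ p ∷ Js
  attach on  p h p≤h Js = interval p h p≤h ∷ Js

  attach-label : ∀ k {p} h p≤h Js → (∀ x → x <⁺ h → ¬ (x ∈ ⋃⁺ Js)) →
                 Label (⋃⁺ (attach k p h p≤h Js)) p h k
  attach-label out h _ Js far = λ x _ → far x
  attach-label end h _ Js far =
    (λ x x≈p → here (singleton⁺-≐ x≈p)) ,
    λ { x p<x x<h (here (_ , x≤p)) → <⇒≱ p<x x≤p ; x p<x x<h (there x∈) → far x x<h x∈ }
  attach-label on  h _ Js far = λ x p≤x x≤h → here (p≤x , x≤h)

  -- A cell of kind `on` also contributes its right end `p′`, so the later cells are undisturbed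
  -- only if `p′` already belongs to the union. `closed-meets` obtains this from `Closed`.
  attach-after : ∀ k {p p′} p≤p′ Js → p < p′ → (T (isOn k) → p′ ∈ ⋃⁺ Js) → ∀ x → p′ ≤ x →
                 x ∈ ⋃⁺ Js ⇔ x ∈ ⋃⁺ (attach k p (just p′) p≤p′ Js)
  attach-after out _ Js _    _ _ _    = mk⇔ id id
  attach-after end _ Js p<p′ _ _ p′≤x =
    mk⇔ there λ { (here (_ , x≤p)) → ⊥-elim (<⇒≱ p<p′ (≤.trans p′≤x x≤p)) ; (there x∈) → x∈ }
  attach-after on  _ Js _    p′∈ _ p′≤x =
    mk⇔ there λ { (here (_ , x≤p′)) → ⋃⁺-resp (≤.antisym p′≤x x≤p′) (p′∈ tt) ; (there x∈) → x∈ }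

  StartsAfter : Carrier → List NonEmptyInterval → Set _
  StartsAfter p = All (λ J → p ≤ lo J)

  attach-startsAfter : ∀ k {p} h p≤h {Js} → StartsAfter p Js → StartsAfter p (attach k p h p≤h Js)
  attach-startsAfter out h _ after = after
  attach-startsAfter end h _ after = ≤.refl ∷ after
  attach-startsAfter on  h _ after = ≤.refl ∷ after

  closed-meets : ∀ {A p m o} (G : Grid p m) ks → Labels A G ks → Closed o ks → T o → p ∈ A
  closed-meets {A} ray        (k ∷ []) a       (ok , _) o =
    label-meets {A} {h = nothing} k (ok o) _ a
  closed-meets {A} (p<p′ ◂ G) (k ∷ ks) (a , _) (ok , _) o = label-meets {A} k (ok o) p<p′ a

  labels-closed : ∀ {A p m o} (G : Grid p m) ks → (T o → p ∈ A) → Labels A G ks → Closed o ks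
  labels-closed ray (k ∷ []) p∈A a = (λ { o refl → a _ ≤.refl _ (p∈A o) }) , tt
  labels-closed {A} (p<p′ ◂ G) (k ∷ ks) p∈A (a , as) =
    (λ { o refl → a _ ≤.refl p<p′ (p∈A o) }) , labels-closed G ks (p′∈A k a) as
    where
    p′∈A : ∀ k → Label A _ (just _) k → T (isOn k) → _ ∈ A
    p′∈A on a _ = a _ (inj₁ p<p′) ≤.refl

  Realisation : ∀ {n p m} → Vec 𝒫fci n → Word (suc n) m → Grid p m → List NonEmptyInterval → Set _
  Realisation {p = p} ρ w G Js =
    StartsAfter p Js × Labels (⋃⁺ Js) G (column zero w) × Cells ρ G (map tail w)

  realise-cons : ∀ {n p p′ m} (ρ : Vec 𝒫fci n) k a w (G : Grid p′ m) Js (p<p′ : p < p′) →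
    CellAt ρ p (just p′) a → Closed (isOn k) (column zero w) → Realisation ρ w G Js →
    Realisation ρ ((k ∷ a) ∷ w) (p<p′ ◂ G) (attach k p (just p′) (inj₁ p<p′) Js)
  realise-cons {p = p} {p′} ρ k a w G Js p<p′ cell cl (after , labels , cells) =
    attach-startsAfter k (just p′) (inj₁ p<p′) (All.map (≤.trans (inj₁ p<p′)) after) ,
    (attach-label k (just p′) (inj₁ p<p′) Js far ,
     labels-cong G _ (attach-after k (inj₁ p<p′) Js p<p′ (closed-meets G _ labels cl)) labels) ,
    λ i → cell i , cells i
    where
    far : ∀ x → x < p′ → ¬ (x ∈ ⋃⁺ Js)
    far x x<p′ x∈ with find x∈
    ... | J , J∈ , l≤x , _ = <⇒≱ x<p′ (≤.trans (All.lookup after J∈) l≤x)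

  -- Conversely to `refine`, a subdivision given on words is carried out by actual cut points:
  -- density gives room in a bounded cell, the missing right endpoint in the ray. The set is
  -- assembled from the right, one `attach` per cell.
  realise : ∀ {n p m m′} (ρ : Vec 𝒫fci n) (G : Grid p m) w → Cells ρ G w →
    ∀ o (w′ : Word (suc n) m′) → w ⊴ map tail w′ → Closed o (column zero w′) →
    ∃₂ λ (G′ : Grid p m′) Js → Realisation ρ w′ G′ Js
  realise ρ ray (a ∷ []) cells o ((k ∷ a) ∷ []) (next done) _ =
    ray , attach k _ nothing _ [] , attach-startsAfter k nothing _ [] ,
    attach-label k nothing _ [] (λ _ _ ()) , cells
  realise ρ ray (a ∷ []) cells o ((k ∷ a) ∷ (_ ∷ _)) (next ()) _
  realise ρ (p<p′ ◂ G) (a ∷ w) cells o ((k ∷ a) ∷ w′) (next r) (_ , cl)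
    with realise ρ G w (proj₂ ∘ cells) (isOn k) w′ r cl
  ... | G′ , Js , R = p<p′ ◂ G′ , _ , realise-cons ρ k a w′ G′ Js p<p′ (proj₁ ∘ cells) cl R
  realise {p = p} ρ ray (a ∷ []) cells o ((k ∷ a) ∷ w′) (repeat r) (_ , cl)
    with no-right-endpoint p
  ... | x , p<x with realise ρ (ray {x}) _ (cell-stay ρ a p<x cells) (isOn k) w′ r cl
  ...   | G′ , Js , R = p<x ◂ G′ , _ , realise-cons ρ k a w′ G′ Js p<x
    (cell-shrink {h = nothing} ρ a _ cells) cl R
  realise ρ (p<p′ ◂ G) (a ∷ w) cells o ((k ∷ a) ∷ w′) (repeat r) (_ , cl) with dense p<p′
  ... | x , p<x , x<p′
    with realise ρ (x<p′ ◂ G) _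
           (λ i → cell-stay ρ a p<x (proj₁ ∘ cells) i , proj₂ (cells i)) (isOn k) w′ r cl
  ...   | G′ , Js , R = p<x ◂ G′ , _ , realise-cons ρ k a w′ G′ Js p<x
    (cell-shrink ρ a x<p′ (proj₁ ∘ cells)) cl R

  gridFor : ∀ {n} (ρ : Vec 𝒫fci n) → ∃[ m ] ∃₂ λ (G : Grid 0# m) w → Cells ρ G w
  gridFor []      = 1 , ray , [] ∷ [] , λ ()
  gridFor (A ∷ ρ) with gridFor ρ
  ... | _ , G , w , cells with refine A ρ G w cells
  ...   | m , G′ , w′ , _ , cells′ = m , G′ , w′ , cells′

  -- Definable properties are recognised by automata.

  -- Since `correct` holds on every fitting grid, a single one decides `P`, complementing the
  -- automaton negates `P`, and `rec-∃` may pass to a finer grid.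
  record Recognizable {n a} (P : Vec 𝒫fci n → Set a) : Set (a ⊔ lsuc (c ⊔ ℓ₁ ⊔ ℓ₂)) where
    field
      dfa     : DFA n
      correct : ∀ {m} (G : Grid 0# m) ρ w → Cells ρ G w → P ρ ⇔ DFA.Accepts dfa w

    dec : ∀ ρ → Dec (P ρ)
    dec ρ = let _ , G , w , cells = gridFor ρ ; P⇔ = correct G ρ w cells
            in map′ (from P⇔) (to P⇔) (Bool.T? _)

  open Recognizable

  infixr 2 _⟨⇔⟩_
  _⟨⇔⟩_ : ∀ {a b d} {A : Set a} {B : Set b} {D : Set d} → A ⇔ B → B ⇔ D → A ⇔ D
  f ⟨⇔⟩ g = mk⇔ (to g ∘ to f) (from f ∘ from g)

  rec-⇔ : ∀ {n a b} {P : Vec 𝒫fci n → Set a} {Q : Vec 𝒫fci n → Set b} →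
          (∀ ρ → Q ρ ⇔ P ρ) → Recognizable P → Recognizable Q
  rec-⇔ Q⇔P r = record { dfa = dfa r ; correct = λ G ρ w cells → Q⇔P ρ ⟨⇔⟩ correct r G ρ w cells }

  rec-¬ : ∀ {n a} {P : Vec 𝒫fci n → Set a} → Recognizable P → Recognizable (λ ρ → ¬ P ρ)
  rec-¬ r = record
    { dfa = complement (dfa r)
    ; correct = λ G ρ w cells → let P⇔ = correct r G ρ w cells in
        mk⇔ (_∘ from P⇔) (_∘ to P⇔) ⟨⇔⟩ complement-accepts (dfa r) w }

  rec-× : ∀ {n a b} {P : Vec 𝒫fci n → Set a} {Q : Vec 𝒫fci n → Set b} →
          Recognizable P → Recognizable Q → Recognizable (λ ρ → P ρ × Q ρ)
  rec-× r s = record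
    { dfa = product (dfa r) (dfa s)
    ; correct = λ G ρ w cells →
        let P⇔ = correct r G ρ w cells ; Q⇔ = correct s G ρ w cells in
        mk⇔ (λ (p , q) → to P⇔ p , to Q⇔ q) (λ (p , q) → from P⇔ p , from Q⇔ q)
          ⟨⇔⟩ product-accepts (dfa r) (dfa s) w }

  -- A witness need not fit the given grid, so `refine` subdivides it; in the other direction
  -- `realise` produces the witness together with a grid that fits it.
  rec-∃ : ∀ {n a} {P : Vec 𝒫fci (suc n) → Set a} → Recognizable P →
          Recognizable (λ ρ → ∃[ A ] P (A ∷ ρ))
  rec-∃ {n} {P = P} r = record
    { dfa     = projection
    ; correct = λ G ρ w cells → mk⇔ (⇒ G ρ w cells) (⇐ G ρ w cells) ⟨⇔⟩ projection-accepts w }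
    where
    open Projection (dfa r)
    Ext : ∀ {m} → Word n m → Set
    Ext = Extends (DFA.start (dfa r) , false)
    ⇒ : ∀ {m} (G : Grid 0# m) ρ w → Cells ρ G w → ∃[ A ] P (A ∷ ρ) → Ext w
    ⇒ G ρ w cells (A , p) with refine A ρ G w cells
    ... | m′ , G′ , w′ , w⊴ , cells′ =
      m′ , w′ , w⊴ , labels-closed G′ (column zero w′) (λ ()) (cells′ zero) ,
      to (correct r G′ (A ∷ ρ) w′ cells′) p
    ⇐ : ∀ {m} (G : Grid 0# m) ρ w → Cells ρ G w → Ext w → ∃[ A ] P (A ∷ ρ)
    ⇐ G ρ w cells (m′ , w′ , w⊴ , cl , acc) with realise ρ G w cells false w′ w⊴ cl
    ... | G′ , Js , _ , labels , cells′ =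
      A , from (correct r G′ (A ∷ ρ) w′ (cells-∷ A ρ G′ w′ labels cells′)) acc
      where
      A : 𝒫fci
      A = ⋃⁺ Js , toFci Js (id , id)

  select : ∀ {a} {A : Set a} {k n} → (Fin k → Fin n) → Vec A n → Vec A k
  select σ xs = tabulate (lookup xs ∘ σ)

  rec-select : ∀ {k n a} {P : Vec 𝒫fci k → Set a} (σ : Fin k → Fin n) →
               Recognizable P → Recognizable (P ∘ select σ)
  rec-select {k} {n} σ r = record
    { dfa     = relabel (select σ) (dfa r)
    ; correct = λ G ρ w cells →
        correct r G (select σ ρ) (map (select σ) w) (select-cells G ρ w cells)
          ⟨⇔⟩ relabel-accepts (select σ) (dfa r) w }
    where
    column-select : ∀ {m} i (w : Word n m) → column (σ i) w ≡ column i (map (select σ) w)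
    column-select i []      = refl
    column-select i (a ∷ w) = cong₂ _∷_ (sym (lookup∘tabulate (lookup a ∘ σ) i)) (column-select i w)
    select-cells : ∀ {m} (G : Grid 0# m) ρ w → Cells ρ G w → Cells (select σ ρ) G (map (select σ) w)
    select-cells G ρ w cells i
      rewrite lookup∘tabulate (lookup ρ ∘ σ) i | sym (column-select i w) = cells (σ i)

  infix 4 _≗_
  _≗_ : 𝒫fci → 𝒫fci → Set _
  A ≗ B = proj₁ A ≐ proj₁ B

  ≗-refl : ∀ A → A ≗ A
  ≗-refl A = id , id

  ≗-trans : ∀ {A B C} → A ≗ B → B ≗ C → A ≗ C
  ≗-trans (f , f′) (g , g′) = (λ x → g (f x)) , (λ x → f′ (g′ x))

  module _ {f : Operation} (t : Trackable f) where
    open Trackable t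

    private
      same-labels : ∀ {m A B} (G : Grid 0# m) ks → Labels A G ks → Labels B G ks → A ≐ B
      same-labels G ks a b =
        labels-⊆ G ks a b (0#-minimum _) , labels-⊆ G ks b a (0#-minimum _)

    rec-operation : Recognizable λ (ρ : Vec 𝒫fci 3) →
      lookup ρ zero ≗ f (lookup ρ (suc zero)) (lookup ρ (suc (suc zero)))
    rec-operation = record
      { dfa     = Graph.dfa graph
      ; correct = λ G ρ w cells →
          let fAB = tracks G _ _ (cells (suc zero)) (cells (suc (suc zero))) in
          mk⇔ (λ z≗ → labels-unique G (labels-≐ G _ z≗ (cells zero)) fAB)
              (λ eq → same-labels G _ (cells zero) (subst (Labels _ G) (sym eq) fAB))
            ⟨⇔⟩ Graph.correct graph w
      }

    -- This needs no separate argument for each operation: equal arguments share their words on a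
    -- common grid, hence so do the values, and a word determines its set.
    operation-cong : ∀ {A A′ B B′} → A ≗ A′ → B ≗ B′ → f A B ≗ f A′ B′
    operation-cong {A} {A′} {B} {B′} A≗ B≗ with gridFor (A ∷ B ∷ [])
    ... | _ , G , w , cells = same-labels G _
      (tracks G A B (cells zero) (cells (suc zero)))
      (tracks G A′ B′ (labels-≐ G _ A≗ (cells zero)) (labels-≐ G _ B≗ (cells (suc zero))))

    -- Terms are unnested: the values of the two subterms become extra tracks, which are then
    -- projected away.
    rec-apply : ∀ {n} (s t : Vec 𝒫fci n → 𝒫fci) →
      Recognizable (λ ρ → head ρ ≗ s (tail ρ)) → Recognizable (λ ρ → head ρ ≗ t (tail ρ)) →
      Recognizable (λ ρ → head ρ ≗ f (s (tail ρ)) (t (tail ρ)))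
    rec-apply {n} s t rs rt = rec-⇔ (λ { (z ∷ ρ) → mk⇔ (λ z≗ → ⇒ z ρ z≗) (⇐ z ρ) })
      (rec-∃ (rec-∃ (rec-×
        (rec-× (rec-select σ₁ rs) (rec-select σ₂ rt)) (rec-select σ₃ rec-operation))))
      where
      -- Under the two quantifiers the tracks are `v`, `u`, `z` and then `ρ`.
      σ₁ σ₂ : Fin (suc n) → Fin (suc (suc (suc n)))
      σ₁ zero    = suc zero
      σ₁ (suc i) = suc (suc (suc i))
      σ₂ zero    = zero
      σ₂ (suc i) = suc (suc (suc i))
      σ₃ : Fin 3 → Fin (suc (suc (suc n)))
      σ₃ zero             = suc (suc zero)
      σ₃ (suc zero)       = suc zero
      σ₃ (suc (suc zero)) = zero
      Flat : 𝒫fci → Vec 𝒫fci n → 𝒫fci → 𝒫fci → Set _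
      Flat z ρ u v = (u ≗ s (select id ρ) × v ≗ t (select id ρ)) × z ≗ f u v
      ⇒ : ∀ z ρ → z ≗ f (s ρ) (t ρ) → ∃[ u ] ∃[ v ] Flat z ρ u v
      ⇒ z ρ z≗ rewrite tabulate∘lookup ρ = s ρ , t ρ , (≗-refl (s ρ) , ≗-refl (t ρ)) , z≗
      ⇐ : ∀ z ρ → ∃[ u ] ∃[ v ] Flat z ρ u v → z ≗ f (s ρ) (t ρ)
      ⇐ z ρ (u , v , (u≗ , v≗) , z≗) rewrite tabulate∘lookup ρ =
        ≗-trans {z} {f u v} {f (s ρ) (t ρ)} z≗ (operation-cong u≗ v≗)

  rec-term : ∀ {n} (t : Term n) → Recognizable (λ ρ → head ρ ≗ ⟦ t ⟧ᵗ (tail ρ))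
  rec-term (# i)    = rec-⇔ (λ { (z ∷ ρ) → mk⇔ id id })
    (rec-select (λ { zero → zero ; (suc _) → suc i }) (rec-operation first-trackable))
  rec-term (s ∪′ t) = rec-apply ∪-trackable ⟦ s ⟧ᵗ ⟦ t ⟧ᵗ (rec-term s) (rec-term t)
  rec-term (s ∩′ t) = rec-apply ∩-trackable ⟦ s ⟧ᵗ ⟦ t ⟧ᵗ (rec-term s) (rec-term t)
  rec-term ⊥′       = rec-⇔ (λ { (z ∷ ρ) → mk⇔ id id })
    (rec-select (λ _ → zero) (rec-operation ∅-trackable))
  rec-term c₀       = rec-⇔ (λ { (z ∷ ρ) → mk⇔ id id })
    (rec-select (λ _ → zero) (rec-operation zero-trackable))
  rec-term (min′ t) = rec-apply min-trackable ⟦ t ⟧ᵗ ⟦ t ⟧ᵗ (rec-term t) (rec-term t)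
  rec-term (max′ t) = rec-apply max-trackable ⟦ t ⟧ᵗ ⟦ t ⟧ᵗ (rec-term t) (rec-term t)
  rec-term (l′ t)   = rec-apply left-trackable ⟦ t ⟧ᵗ ⟦ t ⟧ᵗ (rec-term t) (rec-term t)
  rec-term (r′ t)   = rec-apply right-trackable ⟦ t ⟧ᵗ ⟦ t ⟧ᵗ (rec-term t) (rec-term t)

  -- Disjunction, implication and the universal quantifier go through their classical equivalents.
  -- These are valid here because `dec` decides every formula already shown recognizable.
  rec-formula : ∀ {n} (φ : Formula n) → Recognizable (_⊨ φ)
  rec-formula (s ≐′ t) = rec-⇔
    (λ ρ → mk⇔
      (λ (lift s≗t) → ⟦ s ⟧ᵗ ρ , ≗-refl (⟦ s ⟧ᵗ ρ) , s≗t)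
      (λ (z , z≗s , z≗t) → lift (≗-trans {⟦ s ⟧ᵗ ρ} {z} {⟦ t ⟧ᵗ ρ} (≐-sym z≗s) z≗t)))
    (rec-∃ (rec-× (rec-term s) (rec-term t)))
  rec-formula (¬′ φ)   = rec-¬ (rec-formula φ)
  rec-formula (φ ∧′ ψ) = rec-× (rec-formula φ) (rec-formula ψ)
  rec-formula (φ ∨′ ψ) = rec-⇔
    (λ ρ → mk⇔ (λ { (inj₁ p) (¬p , _) → ¬p p ; (inj₂ q) (_ , ¬q) → ¬q q })
               (λ ¬¬ → decidable-stable (dec (rec-formula φ) ρ ⊎-dec dec (rec-formula ψ) ρ)
                         λ ¬p∨q → ¬¬ (¬p∨q ∘ inj₁ , ¬p∨q ∘ inj₂)))
    (rec-¬ (rec-× (rec-¬ (rec-formula φ)) (rec-¬ (rec-formula ψ))))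
  rec-formula (φ ⇒′ ψ) = rec-⇔
    (λ ρ → mk⇔ (λ f (p , ¬q) → ¬q (f p))
               (λ ¬p∧¬q p → decidable-stable (dec (rec-formula ψ) ρ) λ ¬q → ¬p∧¬q (p , ¬q)))
    (rec-¬ (rec-× (rec-formula φ) (rec-¬ (rec-formula ψ))))
  rec-formula (∀′ φ)   = rec-⇔
    (λ ρ → mk⇔ (λ f (A , ¬p) → ¬p (f A))
               (λ ¬∃ A → decidable-stable (dec (rec-formula φ) (A ∷ ρ)) λ ¬p → ¬∃ (A , ¬p)))
    (rec-¬ (rec-∃ (rec-¬ (rec-formula φ))))
  rec-formula (∃′ φ)   = rec-∃ (rec-formula φ)

  -- The existential formula for an accepting run.

  infix 6 _⊑_
  _⊑_ : ∀ {n} → Term n → Term n → Formula n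
  s ⊑ t = s ∪′ t ≐′ t

  ⋁ : ∀ {n N} → (Fin N → Term n) → Term n
  ⋁ {N = zero}  f = ⊥′
  ⋁ {N = suc N} f = f zero ∪′ ⋁ (f ∘ suc)

  ⋀ : ∀ {n N} → (Fin N → Formula n) → Formula n
  ⋀ {N = zero}  f = ⊥′ ≐′ ⊥′
  ⋀ {N = suc N} f = f zero ∧′ ⋀ (f ∘ suc)

  ∃^ : ∀ {n} N → Formula (N + n) → Formula n
  ∃^ zero    φ = φ
  ∃^ (suc N) φ = ∃^ N (∃′ φ)

  ⋀-quantifierFree : ∀ {n N} {f : Fin N → Formula n} → (∀ i → QuantifierFree (f i)) →
                     QuantifierFree (⋀ f)
  ⋀-quantifierFree {N = zero}  qf = ⊥′ ≐′ ⊥′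
  ⋀-quantifierFree {N = suc N} qf = qf zero ∧′ ⋀-quantifierFree (qf ∘ suc)

  ∃^-existential : ∀ {n} N {φ : Formula (N + n)} → Existential φ → Existential (∃^ N φ)
  ∃^-existential zero    ex = ex
  ∃^-existential (suc N) ex = ∃^-existential N (∃′ ex)

  ⊨-⊑ : ∀ {n} (ρ : Vec 𝒫fci n) s t →
        (ρ ⊨ s ⊑ t) ⇔ (∀ x → x ∈ proj₁ (⟦ s ⟧ᵗ ρ) → x ∈ proj₁ (⟦ t ⟧ᵗ ρ))
  ⊨-⊑ ρ s t = mk⇔ ⇒ ⇐
    where
    ⇒ : ρ ⊨ s ⊑ t → ∀ x → x ∈ proj₁ (⟦ s ⟧ᵗ ρ) → x ∈ proj₁ (⟦ t ⟧ᵗ ρ)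
    ⇒ (lift (f , _)) x p = f (inj₁ p)
    ⇐ : (∀ x → x ∈ proj₁ (⟦ s ⟧ᵗ ρ) → x ∈ proj₁ (⟦ t ⟧ᵗ ρ)) → ρ ⊨ s ⊑ t
    ⇐ f = lift ([ f _ , id ]′ , inj₂)

  ⊨-⊥ : ∀ {n} (ρ : Vec 𝒫fci n) t → (ρ ⊨ t ≐′ ⊥′) ⇔ (∀ x → ¬ (x ∈ proj₁ (⟦ t ⟧ᵗ ρ)))
  ⊨-⊥ ρ t = mk⇔ ⇒ ⇐
    where
    ⇒ : ρ ⊨ t ≐′ ⊥′ → ∀ x → ¬ (x ∈ proj₁ (⟦ t ⟧ᵗ ρ))
    ⇒ (lift (f , _)) x p = Level.lower (f p)
    ⇐ : (∀ x → ¬ (x ∈ proj₁ (⟦ t ⟧ᵗ ρ))) → ρ ⊨ t ≐′ ⊥′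
    ⇐ f = lift ((λ x∈ → ⊥-elim (f _ x∈)) , λ ())

  ∈-⋁ : ∀ {n N} (ρ : Vec 𝒫fci n) (f : Fin N → Term n) {x} →
        x ∈ proj₁ (⟦ ⋁ f ⟧ᵗ ρ) ⇔ (∃[ i ] x ∈ proj₁ (⟦ f i ⟧ᵗ ρ))
  ∈-⋁ {N = zero}  ρ f = mk⇔ (λ ()) (λ ())
  ∈-⋁ {N = suc N} ρ f = mk⇔
    [ (zero ,_) , (λ x∈ → let i , p = to (∈-⋁ ρ (f ∘ suc)) x∈ in suc i , p) ]′
    λ { (zero , p) → inj₁ p ; (suc i , p) → inj₂ (from (∈-⋁ ρ (f ∘ suc)) (i , p)) }

  ⊨-⋀ : ∀ {n N} (ρ : Vec 𝒫fci n) (f : Fin N → Formula n) → (ρ ⊨ ⋀ f) ⇔ (∀ i → ρ ⊨ f i)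
  ⊨-⋀ {N = zero}  ρ f = mk⇔ (λ _ ()) (λ _ → lift (≗-refl (⟦ ⊥′ ⟧ᵗ ρ)))
  ⊨-⋀ {N = suc N} ρ f = mk⇔
    (λ { (p , ps) zero → p ; (p , ps) (suc i) → to (⊨-⋀ ρ (f ∘ suc)) ps i })
    (λ p → p zero , from (⊨-⋀ ρ (f ∘ suc)) (p ∘ suc))

  ⊨-∃^ : ∀ {n} N (ρ : Vec 𝒫fci n) (φ : Formula (N + n)) →
         (ρ ⊨ ∃^ N φ) ⇔ (∃[ As ] (Vec._++_ {m = N} As ρ ⊨ φ))
  ⊨-∃^ zero    ρ φ = mk⇔ ([] ,_) (λ { ([] , p) → p })
  ⊨-∃^ (suc N) ρ φ = ⊨-∃^ N ρ (∃′ φ) ⟨⇔⟩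
    mk⇔ (λ (As , A , p) → A ∷ As , p) (λ { (A ∷ As , p) → As , A , p })

  -- An accepting run is encoded by sets X i, where X i is the union of the cells
  -- on which the run is in the state and reads the letter recorded in i.  The
  -- parity bit alternates along the run, so that the cells making up one X i are
  -- disjoint and hence are its maximal intervals.
  module RunFormula {n} (D : DFA n) (cellTypes : Enumeration (Bool × DFA.State D × Letter n)) where
    open DFA D
    open Enumeration cellTypes using ()
      renaming (size to N; decode to typeOf; encode to indexOf; decode-encode to typeOf-indexOf)

    parity : Fin N → Bool
    parity = proj₁ ∘ typeOf

    state after : Fin N → State
    state i = proj₁ (proj₂ (typeOf i))
    after i = δ (state i) (proj₂ (proj₂ (typeOf i)))

    letter : Fin N → Letter n
    letter = proj₂ ∘ proj₂ ∘ typeOf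

    X : Fin N → Term (N + n)
    X i = # (i ↑ˡ n)

    V : Fin n → Term (N + n)
    V v = # (N ↑ʳ v)

    leftEndsAt : State → Term (N + n)
    leftEndsAt s = ⋁ λ j → if isYes (_≟_ states (state j) s) then l′ (X j) else ⊥′

    -- The set `s` consists of closed cells, whereas a kind concerns the cell without its right end;
    -- hence `out` and `end` exempt `r′ s`.
    labelled′ : Kind → Term (N + n) → Term (N + n) → Formula (N + n)
    labelled′ out s t = (s ∩′ t) ⊑ r′ s
    labelled′ end s t = l′ s ⊑ t ∧′ (s ∩′ t) ⊑ (l′ s ∪′ r′ s)
    labelled′ on  s t = s ⊑ t

    -- A set without a maximum is empty or unbounded, so the implication forbids the last cell, the
    -- ray, to have a type that leads to a rejecting state.
    bounded′ : Bool → Term (N + n) → Formula (N + n)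
    bounded′ true  s = ⊥′ ≐′ ⊥′
    bounded′ false s = max′ s ≐′ ⊥′ ⇒′ s ≐′ ⊥′

    -- It is not stated that the sets cover the line without overlap. One chain of linked cells
    -- starting at 0 is enough: the condition on `l′` and `r′` makes each cell have positive length,
    -- so the chain advances and, being finite, ends in a ray.
    matrix : Formula (N + n)
    matrix = c₀ ⊑ leftEndsAt start ∧′ ⋀ λ i →
      (l′ (X i) ∩′ r′ (X i)) ≐′ ⊥′ ∧′
      r′ (X i) ⊑ leftEndsAt (after i) ∧′
      bounded′ (final (after i)) (X i) ∧′
      ⋀ λ v → labelled′ (lookup (letter i) v) (X i) (V v)

    runFormula : Formula n
    runFormula = ∃^ N matrix

    runFormula-existential : Existential runFormula
    runFormula-existential = ∃^-existential N (quantifierFree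
      ((_ ≐′ _) ∧′ ⋀-quantifierFree λ i →
        (_ ≐′ _) ∧′ (_ ≐′ _) ∧′ bounded-qf (final (after i)) ∧′
        ⋀-quantifierFree λ v → labelled-qf (lookup (letter i) v)))
      where
      bounded-qf : ∀ b {s} → QuantifierFree (bounded′ b s)
      bounded-qf true  = _ ≐′ _
      bounded-qf false = (_ ≐′ _) ⇒′ (_ ≐′ _)
      labelled-qf : ∀ k {s t} → QuantifierFree (labelled′ k s t)
      labelled-qf out = _ ≐′ _
      labelled-qf end = (_ ≐′ _) ∧′ (_ ≐′ _)
      labelled-qf on  = _ ≐′ _

    Labelled : Kind → Subset → Subset → Set (c ⊔ ℓ₁ ⊔ ℓ₂)
    Labelled out A B = ∀ x → x ∈ A × x ∈ B → x ∈ RightEnds A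
    Labelled end A B = (∀ x → x ∈ LeftEnds A → x ∈ B) ×
                       (∀ x → x ∈ A × x ∈ B → x ∈ LeftEnds A ⊎ x ∈ RightEnds A)
    Labelled on  A B = ∀ x → x ∈ A → x ∈ B

    record Consistent (A : Fin N → 𝒫fci) (B : Fin n → 𝒫fci) : Set (c ⊔ ℓ₁ ⊔ ℓ₂) where
      field
        begins   : ∃[ i ] state i ≡ start × 0# ∈ LeftEnds (proj₁ (A i))
        proper   : ∀ i x → ¬ (x ∈ LeftEnds (proj₁ (A i)) × x ∈ RightEnds (proj₁ (A i)))
        linked   : ∀ i x → x ∈ RightEnds (proj₁ (A i)) →
                   ∃[ j ] state j ≡ after i × x ∈ LeftEnds (proj₁ (A j))
        bounded  : ∀ i → ¬ T (final (after i)) → (∀ x → ¬ (x ∈ Max (proj₁ (A i)))) →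
                   ∀ x → ¬ (x ∈ proj₁ (A i))
        labelled : ∀ i v → Labelled (lookup (letter i) v) (proj₁ (A i)) (proj₁ (B v))

    module _ (ρ : Vec 𝒫fci (N + n)) where

      ∈-leftEndsAt : ∀ s {x} → x ∈ proj₁ (⟦ leftEndsAt s ⟧ᵗ ρ) ⇔
                     (∃[ j ] state j ≡ s × x ∈ LeftEnds (proj₁ (⟦ X j ⟧ᵗ ρ)))
      ∈-leftEndsAt s {x} = ∈-⋁ ρ _ ⟨⇔⟩
        mk⇔ (λ (j , p) → j , to (guarded j) p) (λ (j , p) → j , from (guarded j) p)
        where
        guarded : ∀ j → x ∈ proj₁ (⟦ if isYes (_≟_ states (state j) s) then l′ (X j) else ⊥′ ⟧ᵗ ρ) ⇔
                        (state j ≡ s × x ∈ LeftEnds (proj₁ (⟦ X j ⟧ᵗ ρ)))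
        guarded j with _≟_ states (state j) s
        ... | yes eq = mk⇔ (eq ,_) proj₂
        ... | no neq = mk⇔ (λ ()) (λ (eq , _) → ⊥-elim (neq eq))

      ⊨-labelled : ∀ k s t →
                   (ρ ⊨ labelled′ k s t) ⇔ Labelled k (proj₁ (⟦ s ⟧ᵗ ρ)) (proj₁ (⟦ t ⟧ᵗ ρ))
      ⊨-labelled out s t = ⊨-⊑ ρ (s ∩′ t) (r′ s)
      ⊨-labelled end s t = mk⇔
        (λ (p , q) → to (⊨-⊑ ρ (l′ s) t) p , to (⊨-⊑ ρ (s ∩′ t) (l′ s ∪′ r′ s)) q)
        (λ (p , q) → from (⊨-⊑ ρ (l′ s) t) p , from (⊨-⊑ ρ (s ∩′ t) (l′ s ∪′ r′ s)) q)
      ⊨-labelled on  s t = ⊨-⊑ ρ s t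

      ⊨-bounded : ∀ b s → (ρ ⊨ bounded′ b s) ⇔
        (¬ T b → (∀ x → ¬ (x ∈ Max (proj₁ (⟦ s ⟧ᵗ ρ)))) → ∀ x → ¬ (x ∈ proj₁ (⟦ s ⟧ᵗ ρ)))
      ⊨-bounded true  s = mk⇔ (λ _ ¬t → ⊥-elim (¬t tt)) (λ _ → lift (≗-refl (⟦ ⊥′ ⟧ᵗ ρ)))
      ⊨-bounded false s = mk⇔
        (λ f _ none → to (⊨-⊥ ρ s) (f (from (⊨-⊥ ρ (max′ s)) none)))
        (λ f none → from (⊨-⊥ ρ s) (f id (to (⊨-⊥ ρ (max′ s)) none)))

      ⊨-matrix : (ρ ⊨ matrix) ⇔ Consistent (λ i → ⟦ X i ⟧ᵗ ρ) (λ v → ⟦ V v ⟧ᵗ ρ)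
      ⊨-matrix = mk⇔
        (λ (first , rest) →
          let part : ∀ i → _
              part = to (⊨-⋀ ρ _) rest in
          record
          { begins   = to (∈-leftEndsAt start)
                         (to (⊨-⊑ ρ c₀ (leftEndsAt start)) first 0# (lift <.Eq.refl))
          ; proper   = λ i → to (⊨-⊥ ρ (l′ (X i) ∩′ r′ (X i))) (proj₁ (part i))
          ; linked   = λ i x x∈ → to (∈-leftEndsAt (after i))
                         (to (⊨-⊑ ρ (r′ (X i)) (leftEndsAt (after i)))
                           (proj₁ (proj₂ (part i))) x x∈)
          ; bounded  = λ i → to (⊨-bounded (final (after i)) (X i)) (proj₁ (proj₂ (proj₂ (part i))))
          ; labelled = λ i v → to (⊨-labelled (lookup (letter i) v) (X i) (V v))
                         (to (⊨-⋀ ρ _) (proj₂ (proj₂ (proj₂ (part i)))) v)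
          })
        (λ C → let open Consistent C in
          from (⊨-⊑ ρ c₀ (leftEndsAt start))
            (λ x (lift x≈0) → fci-resp (proj₂ (⟦ leftEndsAt start ⟧ᵗ ρ)) (<.Eq.sym x≈0)
              (from (∈-leftEndsAt start) begins)) ,
          from (⊨-⋀ ρ _) λ i →
            from (⊨-⊥ ρ (l′ (X i) ∩′ r′ (X i))) (proper i) ,
            from (⊨-⊑ ρ (r′ (X i)) (leftEndsAt (after i)))
              (λ x x∈ → from (∈-leftEndsAt (after i)) (linked i x x∈)) ,
            from (⊨-bounded (final (after i)) (X i)) (bounded i) ,
            from (⊨-⋀ ρ _) (λ v →
              from (⊨-labelled (lookup (letter i) v) (X i) (V v)) (labelled i v)))

    HasRun : Carrier → (Fin n → 𝒫fci) → State → Set (c ⊔ ℓ₁ ⊔ ℓ₂)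
    HasRun p B s = ∃[ m ] ∃₂ λ (G : Grid p m) w →
      (∀ v → Labels (proj₁ (B v)) G (column v w)) × T (accepts s w)

    -- As `A` contains the closed cell, no point of it before `h` is a right endpoint and none after
    -- `p` is a left one, so the exemptions in `Labelled` do not apply inside.
    labelled⇒label : ∀ {A B} → IsFci A → IsFci B → ∀ {p} h k → p <⁺ h → p ∈ LeftEnds A →
                     (∀ x → p ≤ x → x ≤⁺ h → x ∈ A) → Labelled k A B → Label B p h k
    labelled⇒label {A} {B} fA fB {p} h = go
      where
      module _ (p<h : p <⁺ h) (p∈l : p ∈ LeftEnds A) (⊆A : ∀ x → p ≤ x → x ≤⁺ h → x ∈ A) where
        not-right : ∀ x → p ≤ x → x <⁺ h → ¬ (x ∈ RightEnds A)
        not-right x p≤x x<h x∈r =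
          let u , x<u , u<h = between h x<h
          in rightEnd⁻ fA x∈r x<u λ v x≤v v≤u →
               ⊆A v (≤.trans p≤x x≤v) (≤⁺-trans h v≤u (<⁺⇒≤⁺ h u<h))
      go : ∀ k → p <⁺ h → p ∈ LeftEnds A → (∀ x → p ≤ x → x ≤⁺ h → x ∈ A) → Labelled k A B →
           Label B p h k
      go out p<h p∈l ⊆A lab x p≤x x<h x∈B =
        not-right p<h p∈l ⊆A x p≤x x<h (lab x (⊆A x p≤x (<⁺⇒≤⁺ h x<h) , x∈B))
      go end p<h p∈l ⊆A (l⊆B , lab) = label-end {h = h} fB (l⊆B p p∈l) λ x p<x x<h x∈B →
        [ (λ x∈l → leftEnd⁻ fA x∈l p<x λ v p≤v v≤x → ⊆A v p≤v (≤⁺-trans h v≤x (<⁺⇒≤⁺ h x<h)))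
        , not-right p<h p∈l ⊆A x (inj₁ p<x) x<h
        ]′ (lab x (⊆A x (inj₁ p<x) (<⁺⇒≤⁺ h x<h) , x∈B))
      go on p<h p∈l ⊆A lab x p≤x x≤h = lab x (⊆A x p≤x x≤h)

    consistent⇒run : ∀ {A B} → Consistent A B → HasRun 0# B start
    consistent⇒run {A} {B} C = let i , eq , 0∈ = begins in
      subst (HasRun 0# B) eq (follow (List.concat (List.tabulate intervals)) (<-wellFounded _) 0∈
        λ {j} K∈ _ → ∈-concat⁺′ K∈ (∈-tabulate⁺ j))
      where
      open Consistent C
      intervals : Fin N → List NonEmptyInterval
      intervals i = proj₁ (normalForm (proj₂ (A i)))

      -- The list contains all intervals still ahead, so it shrinks in each step.
      follow : ∀ {p i} Ks → Acc ℕ._<_ (List.length Ks) → p ∈ LeftEnds (proj₁ (A i)) →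
               (∀ {j K} → K ∈ˡ intervals j → p ≤ lo K → K ∈ˡ Ks) → HasRun p B (state i)
      follow {p} {i} Ks (access rs) p∈l ahead = visit (leftEnds-normal⁻ nJs A≐ p∈l)
        where
        nJs : Normal (intervals i)
        nJs = proj₁ (proj₂ (normalForm (proj₂ (A i))))
        A≐ : proj₁ (A i) ≐ ⋃⁺ (intervals i)
        A≐ = proj₂ (proj₂ (normalForm (proj₂ (A i))))

        cell : ∀ {J} → J ∈ˡ intervals i → p ≈ lo J → p <⁺ hi J →
               ∀ v → Label (proj₁ (B v)) p (hi J) (lookup (letter i) v)
        cell {J} J∈ p≈l p<h v = labelled⇒label
          (proj₂ (A i)) (proj₂ (B v)) (hi J) (lookup (letter i) v) p<h p∈l
          (λ x p≤x x≤h → proj₂ A≐ (lose J∈ (≤.trans (inj₂ (<.Eq.sym p≈l)) p≤x , x≤h)))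
          (labelled i v)

        visit : ∃[ J ] J ∈ˡ intervals i × p ≈ lo J → HasRun p B (state i)
        visit (interval l nothing _ , J∈ , p≈l) =
          1 , ray , letter i ∷ [] , cell J∈ p≈l _ ,
          -- The ray makes `A i` unbounded; if `after i` were rejecting, `bounded` would make `A i`
          -- empty, yet it contains `p`.
          decidable-stable (Bool.T? _) λ rejecting →
            bounded i rejecting noMax p (leftEnds-⊆ p∈l)
          where
          noMax : ∀ x → ¬ (x ∈ Max (proj₁ (A i)))
          noMax x (_ , ≤x) with upper l x
          ... | u , l≤u , x≤u , _ with no-right-endpoint u
          ...   | y , u<y = <⇒≱ (≤-<-trans x≤u u<y)
            (≤x y (proj₂ A≐ (lose J∈ (≤.trans l≤u (inj₁ u<y) , _))))
        visit (J@(interval l (just b) l≤b) , J∈ , p≈l) =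
          let j , eq , b∈l = linked i b b∈r
              m , G , w , labels , accepting = subst (HasRun b B) eq
                -- The current interval begins at `l < b` and is filtered out, so the list becomes
                -- strictly shorter.
                (follow (List.filter (λ K → b ≤.≤? lo K) Ks)
                  (rs (filter-notAll _ Ks (lose (ahead J∈ (inj₂ p≈l)) (<⇒≱ l<b))))
                  b∈l
                  λ K∈ b≤l → ∈-filter⁺ _ (ahead K∈ (≤.trans (inj₁ p<b) b≤l)) b≤l)
          in suc m , p<b ◂ G , letter i ∷ w , (λ v → cell J∈ p≈l p<b v , labels v) , accepting
          where
          b∈r : b ∈ RightEnds (proj₁ (A i))
          b∈r = rightEnds-normal⁺ nJs A≐ J∈ refl <.Eq.refl
          l<b : l < b
          l<b = [ id , (λ l≈b → ⊥-elim (proper i b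
            (leftEnds-normal⁺ nJs A≐ J∈ (<.Eq.sym l≈b) , b∈r))) ]′ l≤b
          p<b : p < b
          p<b = ≤-<-trans (inj₂ p≈l) l<b

    cellsOf : ∀ {p m} → Bool → State → Grid p m → Word n m → List (Fin N × NonEmptyInterval)
    cellsOf {p} o s ray (a ∷ []) = (indexOf (o , s , a) , interval p nothing _) ∷ []
    cellsOf {p} o s (_◂_ {p′ = p′} p<p′ G) (a ∷ w) =
      (indexOf (o , s , a) , interval p (just p′) (inj₁ p<p′)) ∷ cellsOf (not o) (δ s a) G w

    cellsOf-first : ∀ {p m} o s (G : Grid p m) w →
      ∃₂ λ j K → (j , K) ∈ˡ cellsOf o s G w × state j ≡ s × lo K ≡ p
    cellsOf-first o s ray       (a ∷ []) =
      _ , _ , here refl , cong (proj₁ ∘ proj₂) (typeOf-indexOf (o , s , a)) , refl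
    cellsOf-first o s (_ ◂ G) (a ∷ w) =
      _ , _ , here refl , cong (proj₁ ∘ proj₂) (typeOf-indexOf (o , s , a)) , refl

    -- The disjunction tells the first cell, known by its parity, from those beginning strictly
    -- later. Of two neighbours sharing a point, the parities differ, so their indices do; cells
    -- further on do not touch.
    cellsOf-ahead : ∀ {p m} o s (G : Grid p m) w →
      All (λ (j , K) → p ≤ lo K × (parity j ≡ o ⊎ p < lo K)) (cellsOf o s G w)
    cellsOf-ahead o s ray (a ∷ []) =
      (≤.refl , inj₁ (cong proj₁ (typeOf-indexOf (o , s , a)))) ∷ []
    cellsOf-ahead o s (p<p′ ◂ G) (a ∷ w) =
      (≤.refl , inj₁ (cong proj₁ (typeOf-indexOf (o , s , a)))) ∷
      All.map (λ (p′≤l , _) → inj₁ (<-≤-trans p<p′ p′≤l) , inj₂ (<-≤-trans p<p′ p′≤l))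
        (cellsOf-ahead (not o) (δ s a) G w)

    Separated : (d e : Fin N × NonEmptyInterval) → Set (c ⊔ ℓ₁ ⊔ ℓ₂)
    Separated (i , J) (j , K) = i ≡ j → Disjoint J K

    cellsOf-separated : ∀ {p m} o s (G : Grid p m) w → AllPairs Separated (cellsOf o s G w)
    cellsOf-separated o s ray (a ∷ []) = [] ∷ []
    cellsOf-separated o s (_◂_ {p} {p′} p<p′ G) (a ∷ w) =
      All.map (λ {d} → separate {d}) (cellsOf-ahead (not o) (δ s a) G w) ∷
      cellsOf-separated (not o) (δ s a) G w
      where
      separate : ∀ {d} → p′ ≤ lo (proj₂ d) × (parity (proj₁ d) ≡ not o ⊎ p′ < lo (proj₂ d)) →
                 Separated (indexOf (o , s , a) , interval p (just p′) (inj₁ p<p′)) d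
      separate (_ , inj₁ eq)   refl =
        ⊥-elim (Bool.not-¬ refl (trans (sym (cong proj₁ (typeOf-indexOf (o , s , a)))) eq))
      separate (_ , inj₂ p′<l) _    x (_ , x≤p′) (l≤x , _) = <⇒≱ p′<l (≤.trans l≤x x≤p′)

    record RunCell (B : Fin n → 𝒫fci) (cs : List (Fin N × NonEmptyInterval))
                   (d : Fin N × NonEmptyInterval) : Set (c ⊔ ℓ₁ ⊔ ℓ₂) where
      private
        i = proj₁ d
        K = proj₂ d
      field
        thick     : lo K <⁺ hi K
        labels    : ∀ v → Label (proj₁ (B v)) (lo K) (hi K) (lookup (letter i) v)
        successor : ∀ {b} → hi K ≡ just b → ∃₂ λ j L → (j , L) ∈ˡ cs × state j ≡ after i × lo L ≡ b
        last      : hi K ≡ nothing → T (final (after i))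

    cellsOf-run : ∀ {B p m} o s (G : Grid p m) w → (∀ v → Labels (proj₁ (B v)) G (column v w)) →
                  T (accepts s w) → All (RunCell B (cellsOf o s G w)) (cellsOf o s G w)
    cellsOf-run {B} {p} o s ray (a ∷ []) ks accepting = cell ∷ []
      where
      d = indexOf (o , s , a) , interval p nothing _
      cell : RunCell B (d ∷ []) d
      RunCell.thick     cell = _
      RunCell.labels    cell v rewrite typeOf-indexOf (o , s , a) = ks v
      RunCell.successor cell ()
      RunCell.last      cell _ rewrite typeOf-indexOf (o , s , a) = accepting
    cellsOf-run {B} {p} o s (_◂_ {p′ = p′} p<p′ G) (a ∷ w) ks accepting =
      cell ∷ All.map later (cellsOf-run (not o) (δ s a) G w (proj₂ ∘ ks) accepting)
      where
      i = indexOf (o , s , a)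
      rest = cellsOf (not o) (δ s a) G w
      K = interval p (just p′) (inj₁ p<p′)
      cell : RunCell B ((i , K) ∷ rest) (i , K)
      RunCell.thick     cell = p<p′
      RunCell.labels    cell v rewrite typeOf-indexOf (o , s , a) = proj₁ (ks v)
      RunCell.successor cell refl rewrite typeOf-indexOf (o , s , a) =
        let j , L , L∈ , eq , lo≡ = cellsOf-first (not o) (δ s a) G w in j , L , there L∈ , eq , lo≡
      RunCell.last      cell ()
      later : ∀ {d} → RunCell B rest d → RunCell B ((i , K) ∷ rest) d
      later r = record
        { thick = thick ; labels = labels ; last = last
        ; successor = λ eq → let j , L , L∈ , eqs = successor eq in j , L , there L∈ , eqs }
        where open RunCell r

    fibre : List (Fin N × NonEmptyInterval) → Fin N → List NonEmptyInterval
    fibre cs i = List.map proj₂ (List.filter (λ d → proj₁ d Fin.≟ i) cs)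

    ∈-fibre⁺ : ∀ {cs i K} → (i , K) ∈ˡ cs → K ∈ˡ fibre cs i
    ∈-fibre⁺ iK∈ = ∈-map⁺ proj₂ (∈-filter⁺ _ iK∈ refl)

    ∈-fibre⁻ : ∀ {cs i K} → K ∈ˡ fibre cs i → (i , K) ∈ˡ cs
    ∈-fibre⁻ {cs} {i} K∈ with ∈-map⁻ proj₂ K∈
    ... | _ , d∈ , refl with ∈-filter⁻ (λ d → proj₁ d Fin.≟ i) {xs = cs} d∈
    ...   | d∈cs , refl = d∈cs

    fibre-normal : ∀ {cs} i → AllPairs Separated cs → Normal (fibre cs i)
    fibre-normal {cs} i sep = AllPairs.map⁺
      (disjoint (AllPairs.filter⁺ (λ d → proj₁ d Fin.≟ i) sep) (All.all-filter _ cs))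
      where
      disjoint : ∀ {cs} → AllPairs Separated cs → All (λ d → proj₁ d ≡ i) cs →
                 AllPairs (λ d e → Disjoint (proj₂ d) (proj₂ e)) cs
      disjoint []         []         = []
      disjoint (s ∷ sep) (eq ∷ eqs) =
        All.zipWith (λ (f , eq′) → f (trans eq (sym eq′))) (s , eqs) ∷ disjoint sep eqs

    upperBound : ∀ Ks → (∀ {K} → K ∈ˡ Ks → ¬ hi K ≡ nothing) → ∃[ b ] (∀ x → x ∈ ⋃⁺ Ks → x ≤ b)
    upperBound []                          _     = 0# , λ _ ()
    upperBound (interval _ nothing  _ ∷ _)  bd   = ⊥-elim (bd (here refl) refl)
    upperBound (interval _ (just h) _ ∷ Ks) bd with upperBound Ks (bd ∘ there)
    ... | b , ≤b with upper h b
    ...   | m , h≤m , b≤m , _ =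
      m , λ { x (here (_ , x≤h)) → ≤.trans x≤h h≤m ; x (there x∈) → ≤.trans (≤b x x∈) b≤m }

    -- Being separated, the cells of type `i` form a normal form of `A i`, so its endpoints are
    -- exactly the ends of these cells. Each condition can then be read off from single cells.
    run⇒consistent : ∀ {A : Fin N → 𝒫fci} {B} cs → AllPairs Separated cs → All (RunCell B cs) cs →
      (∀ i → proj₁ (A i) ≐ ⋃⁺ (fibre cs i)) →
      (∃₂ λ i K → (i , K) ∈ˡ cs × state i ≡ start × lo K ≡ 0#) → Consistent A B
    run⇒consistent {A} {B} cs sep runs A≐ (i₀ , K₀ , K₀∈ , eq₀ , lo≡0) = record
      { begins   = i₀ , eq₀ , left (∈-fibre⁺ K₀∈) (<.Eq.reflexive (sym lo≡0))
      ; proper   = proper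
      ; linked   = linked
      ; bounded  = bounded
      ; labelled = λ i v → labelled i v (lookup (letter i) v) (λ K∈ → RunCell.labels (run K∈) v)
      }
      where
      run : ∀ {i K} → K ∈ˡ fibre cs i → RunCell B cs (i , K)
      run K∈ = All.lookup runs (∈-fibre⁻ K∈)

      left : ∀ {i K x} → K ∈ˡ fibre cs i → x ≈ lo K → x ∈ LeftEnds (proj₁ (A i))
      left {i} = leftEnds-normal⁺ (fibre-normal i sep) (A≐ i)

      right : ∀ {i K b x} → K ∈ˡ fibre cs i → hi K ≡ just b → x ≈ b → x ∈ RightEnds (proj₁ (A i))
      right {i} = rightEnds-normal⁺ (fibre-normal i sep) (A≐ i)

      proper : ∀ i x → ¬ (x ∈ LeftEnds (proj₁ (A i)) × x ∈ RightEnds (proj₁ (A i)))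
      proper i x (x∈l , x∈r)
        with leftEnds-normal⁻ (fibre-normal i sep) (A≐ i) x∈l
           | rightEnds-normal⁻ (fibre-normal i sep) (A≐ i) x∈r
      ... | K , K∈ , x≈l | L@(interval _ _ l≤b) , L∈ , b , refl , x≈b
        with unique (fibre-normal i sep) K∈ L∈
               (inj₂ (<.Eq.sym x≈l) , ≤⁺-trans (hi K) (inj₂ x≈l) (nonEmpty K))
               (≤.trans l≤b (inj₂ (<.Eq.sym x≈b)) , inj₂ x≈b)
      ...   | refl = <.irrefl (<.Eq.trans (<.Eq.sym x≈l) x≈b) (RunCell.thick (run K∈))

      linked : ∀ i x → x ∈ RightEnds (proj₁ (A i)) →
               ∃[ j ] state j ≡ after i × x ∈ LeftEnds (proj₁ (A j))
      linked i x x∈r with rightEnds-normal⁻ (fibre-normal i sep) (A≐ i) x∈r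
      ... | K , K∈ , b , hi≡ , x≈b with RunCell.successor (run K∈) hi≡
      ...   | j , L , L∈ , eq , refl = j , eq , left (∈-fibre⁺ L∈) x≈b

      bounded : ∀ i → ¬ T (final (after i)) → (∀ x → ¬ (x ∈ Max (proj₁ (A i)))) →
                ∀ x → ¬ (x ∈ proj₁ (A i))
      bounded i rejecting noMax x x∈ with greatestOf (fibre cs i)
      ... | inj₁ empty = none (subst (λ Ks → x ∈ ⋃⁺ Ks) empty (proj₁ (A≐ i) x∈))
        where
        none : ¬ (x ∈ ⋃⁺ [])
        none ()
      ... | inj₂ (inj₂ (m , m-greatest)) = noMax m (greatest-resp (≐-sym (A≐ i)) m-greatest)
      -- No cell of a rejecting type is the ray, so the union of these cells has an upper bound.
      ... | inj₂ (inj₁ above)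
        with upperBound (fibre cs i) (λ K∈ hi≡ → rejecting (RunCell.last (run K∈) hi≡))
      ...   | b , ≤b = let y , y∈ , b<y = above b in <⇒≱ b<y (≤b y y∈)

      inside⇒right : ∀ {i K x} → K ∈ˡ fibre cs i → x ∈ ⟪ K ⟫ → ¬ (x <⁺ hi K) →
                     x ∈ RightEnds (proj₁ (A i))
      inside⇒right {K = interval _ nothing  _} K∈ _               x≮h = ⊥-elim (x≮h _)
      inside⇒right {K = interval _ (just b) _} K∈ (_ , inj₁ x<b) x≮b = ⊥-elim (x≮b x<b)
      inside⇒right {K = interval _ (just b) _} K∈ (_ , inj₂ x≈b) _   = right K∈ refl x≈b

      labelled : ∀ i v k → (∀ {K} → K ∈ˡ fibre cs i → Label (proj₁ (B v)) (lo K) (hi K) k) →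
                 Labelled k (proj₁ (A i)) (proj₁ (B v))
      labelled i v out label x (x∈A , x∈B) with find (proj₁ (A≐ i) x∈A)
      ... | K , K∈ , x∈K = inside⇒right K∈ x∈K λ x<h → label K∈ x (proj₁ x∈K) x<h x∈B
      labelled i v end label = onLeft , off
        where
        onLeft : ∀ x → x ∈ LeftEnds (proj₁ (A i)) → x ∈ proj₁ (B v)
        onLeft x x∈l with leftEnds-normal⁻ (fibre-normal i sep) (A≐ i) x∈l
        ... | K , K∈ , x≈l = proj₁ (label K∈) x x≈l
        off : ∀ x → x ∈ proj₁ (A i) × x ∈ proj₁ (B v) →
              x ∈ LeftEnds (proj₁ (A i)) ⊎ x ∈ RightEnds (proj₁ (A i))
        off x (x∈A , x∈B) with find (proj₁ (A≐ i) x∈A)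
        ... | K , K∈ , x∈K with ≤-split (proj₁ x∈K)
        ...   | inj₁ x≈l = inj₁ (left K∈ x≈l)
        ...   | inj₂ l<x = inj₂ (inside⇒right K∈ x∈K λ x<h → proj₂ (label K∈) x l<x x<h x∈B)
      labelled i v on label x x∈A with find (proj₁ (A≐ i) x∈A)
      ... | K , K∈ , x∈K = label K∈ x (proj₁ x∈K) (proj₂ x∈K)

    ⊨-runFormula : ∀ ρ → (ρ ⊨ runFormula) ⇔
      (∃[ m ] ∃₂ λ (G : Grid 0# m) w → Cells ρ G w × Accepts w)
    ⊨-runFormula ρ = ⊨-∃^ N ρ matrix ⟨⇔⟩ mk⇔ ⇒ ⇐
      where
      ⇒ : ∃[ As ] (As Vec.++ ρ ⊨ matrix) → ∃[ m ] ∃₂ λ (G : Grid 0# m) w → Cells ρ G w × Accepts w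
      ⇒ (As , p) with consistent⇒run (to (⊨-matrix (As Vec.++ ρ)) p)
      ... | m , G , w , labels , accepting =
        m , G , w ,
        (λ v → subst (λ B → Labels (proj₁ B) G (column v w)) (lookup-++ʳ As ρ v) (labels v)) ,
        accepting
      ⇐ : ∃[ m ] (∃₂ λ (G : Grid 0# m) w → Cells ρ G w × Accepts w) → ∃[ As ] (As Vec.++ ρ ⊨ matrix)
      ⇐ (m , G , w , cells , accepting) = As , from (⊨-matrix (As Vec.++ ρ))
        -- The initial parity is an arbitrary choice; only its alternation matters.
        (run⇒consistent cs (cellsOf-separated false start G w)
          (cellsOf-run false start G w
            (λ v → subst (λ B → Labels (proj₁ B) G (column v w)) (sym (lookup-++ʳ As ρ v))
                     (cells v))
            accepting)
          (λ i → subst (λ A → proj₁ A ≐ ⋃⁺ (fibre cs i)) (sym (A≡ i)) (id , id))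
          (cellsOf-first false start G w))
        where
        cs = cellsOf false start G w
        Aᵢ : Fin N → 𝒫fci
        Aᵢ i = ⋃⁺ (fibre cs i) , toFci (fibre cs i) (id , id)
        As : Vec 𝒫fci N
        As = tabulate Aᵢ
        A≡ : ∀ i → lookup (As Vec.++ ρ) (i ↑ˡ n) ≡ Aᵢ i
        A≡ i = trans (lookup-++ˡ As ρ i) (lookup∘tabulate Aᵢ i)

  -- One direction feeds the grid of `gridFor` to the run formula; the other receives an unrelated
  -- grid extracted from a run. Correctness of the automaton on every grid makes both work.
  modelComplete : ∀ {n} (φ : Formula n) → ∃[ ψ ] Existential ψ × (∀ ρ → (ρ ⊨ φ) ⇔ (ρ ⊨ ψ))
  modelComplete φ = runFormula , runFormula-existential , λ ρ →
    mk⇔ (λ p → let m , G , w , cells = gridFor ρ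
               in from (⊨-runFormula ρ)
                 (m , G , w , cells , to (Recognizable.correct R G ρ w cells) p))
        (λ p → let m , G , w , cells , accepting = to (⊨-runFormula ρ) p
               in from (Recognizable.correct R G ρ w cells) accepting)
    where
    R = rec-formula φ
    D = Recognizable.dfa R
    open RunFormula D
      (×-enumeration Bool-enumeration
        (×-enumeration (DFA.states D) (Vec-enumeration Kind-enumeration _)))

theorem7p1 : ∀ {c ℓ₁ ℓ₂} (I : LeftClosedDenseLinearOrder c ℓ₁ ℓ₂) → let open 𝓛 I in
    ∀ {n} (φ : Formula n) → ∃[ ψ ] Existential ψ × (∀ ρ → (ρ ⊨ φ) ⇔ (ρ ⊨ ψ))
theorem7p1 I = ModelCompleteness.modelComplete I
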